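{- Let $p,q,r$ be pairwise distinct primes with $p<q$ and $p<r$, and write $\Phi_{pqr}(x)=\sum_{n}a_{pqr}(n)x^n$. Put $A_+=\max_n a_{pqr}(n)$ and $A_-=\min_n a_{pqr}(n)$. Let $q',r'\in\{1,\dots,p-1\}$ be the inverses of $q$ and $r$ modulo $p$, let $\alpha=\min\{q',r',p-q',p-r'\}$, and let $\beta$ be the unique integer with $0<\beta<p$ and $\alpha\beta qr\equiv 1 \pmod p$. Then $$A_+\le \min\{2\alpha+\beta,\;p-\beta\},\qquad -A_-\le \min\{p+2\alpha-\beta,\;\beta\}.$$
   Context: $\Phi_{pqr}(x)=\prod_{0<k<pqr,\ \gcd(k,pqr)=1}(x-\zeta^k)$, where $\zeta$ is a primitive $pqr$-th root of unity, is the ternary cyclotomic polynomial; $a_{pqr}(n)$ denotes its coefficient of $x^n$ (zero for $n$ outside $[0,\deg\Phi_{pqr}]$). -}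

module Defs where

open import Algebra.Apartness using (HeytingField; module HeytingCommutativeRing)
open import Algebra.Bundles using (module CommutativeRing; module Semiring)
open import Data.Integer.Base as ℤ using (ℤ; +_; -[1+_])
import Data.Integer.Divisibility as ℤ
open import Data.List.Base using (List; []; _∷_; [_]; map; foldr; filter; upTo)
open import Data.Nat.Base as ℕ using (ℕ; zero; suc; _<_)
open import Data.Nat.GCD using (gcd)
open import Data.Nat.Properties using (_≟_; _<?_)
open import Data.Product.Base using (_×_; ∃-syntax)
open import Relation.Binary.PropositionalEquality.Core using (_≡_)
open import Relation.Nullary.Decidable.Core using (_×-dec_)
open import Relation.Nullary.Negation.Core using (¬_)

infix 4 _≡_[mod_]

_≡_[mod_] : ℕ → ℕ → ℕ → Set
a ≡ b [mod m ] = + m ℤ.∣ (+ a ℤ.- + b)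

record IsInverseMod (p a a′ : ℕ) : Set where
  field
    positive : 0 < a′
    below    : a′ < p
    inverse  : a ℕ.* a′ ≡ 1 [mod p ]

record IsMaximum (a : ℕ → ℤ) (M : ℤ) : Set where
  field
    attained : ∃[ n ] a n ≡ M
    bound    : ∀ n → a n ℤ.≤ M

record IsMinimum (a : ℕ → ℤ) (m : ℤ) : Set where
  field
    attained : ∃[ n ] a n ≡ m
    bound    : ∀ n → m ℤ.≤ a n

-- The standard library has no complex numbers.  Roots of unity are taken in
-- an arbitrary field K of characteristic zero; Heyting fields are used because
-- ℂ is one constructively, whereas its equality is not decidable.
module Cyclotomic {c ℓ₁ ℓ₂} (K : HeytingField c ℓ₁ ℓ₂) where

  open HeytingField K using (Carrier; _≈_; _+_; _*_; -_; 0#; 1#; heytingCommutativeRing)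
  open HeytingCommutativeRing heytingCommutativeRing using (commutativeRing)
  open import Algebra.Definitions.RawSemiring
    (Semiring.rawSemiring (CommutativeRing.semiring commutativeRing))
    using (_^_) renaming (_×_ to _×ₖ_)

  CharacteristicZero : Set ℓ₁
  CharacteristicZero = ∀ n → n ×ₖ 1# ≈ 0# → n ≡ 0

  fromℤ : ℤ → Carrier
  fromℤ (+ n)    = n ×ₖ 1#
  fromℤ -[1+ n ] = - (suc n ×ₖ 1#)

  record IsPrimitiveRoot (n : ℕ) (ζ : Carrier) : Set ℓ₁ where
    field
      root    : ζ ^ n ≈ 1#
      minimal : ∀ k → 0 < k → k < n → ¬ (ζ ^ k ≈ 1#)

  -- Coefficient lists, constant term first; trailing zeros are allowed.
  Poly : Set c
  Poly = List Carrier

  coeff : Poly → ℕ → Carrier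
  coeff []      _       = 0#
  coeff (x ∷ _) zero    = x
  coeff (_ ∷ f) (suc n) = coeff f n

  infixl 6 _+ₚ_
  infixl 7 _*ₚ_

  _+ₚ_ : Poly → Poly → Poly
  []      +ₚ g       = g
  (x ∷ f) +ₚ []      = x ∷ f
  (x ∷ f) +ₚ (y ∷ g) = x + y ∷ f +ₚ g

  _*ₚ_ : Poly → Poly → Poly
  []      *ₚ g = []
  (x ∷ f) *ₚ g = map (x *_) g +ₚ (0# ∷ f *ₚ g)

  ∏ₚ : List Poly → Poly
  ∏ₚ = foldr _*ₚ_ [ 1# ]

  x-_ : Carrier → Poly
  x- y = - y ∷ 1# ∷ []

  units : ℕ → List ℕ
  units n = filter (λ k → (0 <? k) ×-dec (gcd k n ≟ 1)) (upTo n)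

  Φ : ℕ → Carrier → Poly
  Φ n ζ = ∏ₚ (map (λ k → x- (ζ ^ k)) (units n))

  -- Since coeff is zero beyond the length of a list, a is zero above the degree.
  IsCoefficientSequence : Poly → (ℕ → ℤ) → Set ℓ₁
  IsCoefficientSequence f a = ∀ n → coeff f n ≈ fromℤ (a n)

-- Since Φ = (1 − Xᵖᑫʳ)(1 − Xᵖ)(1 − Xᑫ)(1 − Xʳ) / ((1 − X)(1 − Xᵖᑫ)(1 − Xᵖʳ)(1 − Xᑫʳ)), the coefficient at n is the sum over
-- 0 ≤ m < p of c(z) − c(z − q) − c(z − r) + c(z − q − r) with z = n − m, where c comes from the factors p q, p r, q r, p q r.
-- Write z = i q r + j p r + k p q + t p q r with digits 0 ≤ i < p, 0 ≤ j < q, 0 ≤ k < r.  For z < p q r one has t ≤ 0, and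
-- c(z) is 1 if t = 0 and 0 otherwise.  With u = q′ and v = r′, subtracting r lowers i by u and subtracting q lowers i by v,
-- so the borrows of i depend only on the zone containing i, the zones being cut out by u, v and u + v modulo p.  By
-- symmetry u ≤ v, and then (α, β) is (u, v) if u + v ≤ p and (p − v, p − u) otherwise.  In each zone the summand has a
-- constant sign and absolute value at most 1, and outside two zones of length α it is nonzero only for one value of t and
-- of the carries of j and k.  As m runs over the window, i takes every residue once, so counting by zones gives p − β and β;
-- points of the same sign with the same t and carries have their digits i in an interval of length α + β resp.
-- p + α − β, which gives 2 α + β and p + 2 α − β.

module Submission where

open import Defs
open import Algebra.Apartness using (HeytingField; module HeytingCommutativeRing)
open import Algebra.Bundles using (module CommutativeRing)
open import Data.Bool.Base using (Bool; true; false; T; if_then_else_)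
import Data.Bool.Properties as 𝔹
open import Data.Empty using (⊥)
open import Data.Integer.Base as ℤ using (ℤ; +_; -[1+_]; 0ℤ; 1ℤ; -1ℤ; +<+; +≤+; -<+)
import Data.Integer.Properties as ℤ
import Data.Integer.DivMod as ℤ
import Data.Integer.Divisibility.Signed as Signed
open import Data.Integer.Tactic.RingSolver using (solve-∀)
open import Data.List.Base using (List; []; _∷_; [_]; map; foldr; filter; upTo; length)
import Data.List.Properties as List
open import Data.List.Relation.Unary.Any using (here)
open import Data.Nat.Base using (ℕ; zero; suc; _+_; _*_; _∸_; _⊓_; _⊔_; _<_; _≤_; _≤ᵇ_; NonZero; >-nonZero⁻¹;
  nonTrivial⇒n>1; z≤n; s≤s)
import Data.Nat.Properties as ℕ
import Data.Nat.Tactic.RingSolver as ℕ-Solver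
open import Data.Nat.Coprimality using (Coprime; coprime-Bézout; coprime-divisor; coprime⇒gcd≡1; gcd≡1⇒coprime; 1-coprimeTo)
import Data.Nat.Coprimality as Coprimality
open import Data.Nat.Divisibility using (_∣_; _∣?_; divides; ∣-trans; m∣m*n; n∣m*n; >⇒∤; ∣m+n∣m⇒∣n)
open import Data.Nat.GCD using (gcd; module Bézout)
open import Data.Nat.Primality using (Prime; prime⇒irreducible; prime⇒nonTrivial; prime⇒nonZero)
open import Data.Product.Base using (_×_; _,_; ∃-syntax; proj₁; proj₂)
open import Data.Sum.Base using (_⊎_; inj₁; inj₂)
open import Data.Unit.Base using (tt)
open import Data.Vec.Base using (Vec; []; _∷_; replicate)
open import Level using (0ℓ)
open import Relation.Binary.PropositionalEquality using (_≡_; _≢_; refl; sym; trans; cong; cong₂;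
  subst; subst₂; module ≡-Reasoning)
open import Relation.Nullary.Decidable.Core using (Dec; yes; no; does; _×-dec_; _→-dec_; ¬?; toWitness; True)
open import Relation.Nullary.Negation using (¬_; contradiction)
open import Relation.Nullary.Reflects using (ofʸ; ofⁿ)
open import Relation.Unary using (Pred; Decidable)
import Algebra.Properties.Monoid.Mult as Mult
import Algebra.Properties.Ring as RingProperties
import Algebra.Properties.Semiring.Exp as Exp
import Algebra.Solver.Ring.NaturalCoefficients.Default as SemiringSolver
open import Algebra.Properties.AbelianGroup ℤ.+-0-abelianGroup using () renaming (∙-cancelˡ to +-cancelˡ; ∙-cancelʳ to +-cancelʳ)

coprime-inverse : ∀ {a m} → Coprime a m → ∃[ b ] ∃[ c ] + a ℤ.* b ≡ 1ℤ ℤ.+ + m ℤ.* c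
coprime-inverse {a} {m} coprime with coprime-Bézout coprime
... | Bézout.+- x y eq = + x , + y , (begin
  + a ℤ.* + x          ≡⟨ ℤ.*-comm (+ a) (+ x) ⟩
  + x ℤ.* + a          ≡⟨ ℤ.pos-* x a ⟨
  + (x * a)            ≡⟨ cong +_ eq ⟨
  + (1 + y * m)        ≡⟨ cong (ℤ._+_ 1ℤ) (ℤ.pos-* y m) ⟩
  1ℤ ℤ.+ + y ℤ.* + m   ≡⟨ cong (ℤ._+_ 1ℤ) (ℤ.*-comm (+ y) (+ m)) ⟩
  1ℤ ℤ.+ + m ℤ.* + y   ∎)
  where open ≡-Reasoning
... | Bézout.-+ x y eq = ℤ.- + x , ℤ.- + y , (begin
  + a ℤ.* ℤ.- + x                      ≡⟨ neg-*-comm (+ a) (+ x) ⟩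
  1ℤ ℤ.+ ℤ.- (1ℤ ℤ.+ + x ℤ.* + a)      ≡⟨ cong (λ e → 1ℤ ℤ.+ ℤ.- (1ℤ ℤ.+ e)) (ℤ.pos-* x a) ⟨
  1ℤ ℤ.+ ℤ.- + (1 + x * a)             ≡⟨ cong (λ e → 1ℤ ℤ.+ ℤ.- + e) eq ⟩
  1ℤ ℤ.+ ℤ.- + (y * m)                 ≡⟨ cong (λ e → 1ℤ ℤ.+ ℤ.- e) (ℤ.pos-* y m) ⟩
  1ℤ ℤ.+ ℤ.- (+ y ℤ.* + m)             ≡⟨ *-neg-comm (+ y) (+ m) ⟩
  1ℤ ℤ.+ + m ℤ.* ℤ.- + y               ∎)
  where
  open ≡-Reasoning
  neg-*-comm : ∀ a x → a ℤ.* ℤ.- x ≡ 1ℤ ℤ.+ ℤ.- (1ℤ ℤ.+ x ℤ.* a)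
  neg-*-comm = solve-∀
  *-neg-comm : ∀ y m → 1ℤ ℤ.+ ℤ.- (y ℤ.* m) ≡ 1ℤ ℤ.+ m ℤ.* ℤ.- y
  *-neg-comm = solve-∀

opaque
  digit-exists : ∀ {a m} .{{_ : NonZero m}} → Coprime a m → ∀ z →
    ∃[ i ] ∃[ y ] i < m × z ≡ + i ℤ.* + a ℤ.+ + m ℤ.* y
  digit-exists {a} {m} coprime z with coprime-inverse coprime
  ... | b , c , inverse =
    i , y ℤ.* + a ℤ.- z ℤ.* c , ℤ.n%ℕd<d (z ℤ.* b) m , (begin
      z                                                       ≡⟨ expand z (+ m) c ⟩
      z ℤ.* (1ℤ ℤ.+ + m ℤ.* c) ℤ.- + m ℤ.* (z ℤ.* c)          ≡⟨ cong (λ e → z ℤ.* e ℤ.- + m ℤ.* (z ℤ.* c)) inverse ⟨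
      z ℤ.* (+ a ℤ.* b) ℤ.- + m ℤ.* (z ℤ.* c)                 ≡⟨ assoc z (+ a) b (+ m ℤ.* (z ℤ.* c)) ⟩
      (z ℤ.* b) ℤ.* + a ℤ.- + m ℤ.* (z ℤ.* c)                 ≡⟨ cong (λ e → e ℤ.* + a ℤ.- + m ℤ.* (z ℤ.* c)) (ℤ.a≡a%ℕn+[a/ℕn]*n (z ℤ.* b) m) ⟩
      (+ i ℤ.+ y ℤ.* + m) ℤ.* + a ℤ.- + m ℤ.* (z ℤ.* c)       ≡⟨ collect (+ i) y (+ m) (+ a) (z ℤ.* c) ⟩
      + i ℤ.* + a ℤ.+ + m ℤ.* (y ℤ.* + a ℤ.- z ℤ.* c)         ∎)
    where
    open ≡-Reasoning
    i : ℕ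
    i = (z ℤ.* b) ℤ.%ℕ m
    y : ℤ
    y = (z ℤ.* b) ℤ./ℕ m
    expand : ∀ z m c → z ≡ z ℤ.* (1ℤ ℤ.+ m ℤ.* c) ℤ.- m ℤ.* (z ℤ.* c)
    expand = solve-∀
    assoc : ∀ z a b d → z ℤ.* (a ℤ.* b) ℤ.- d ≡ (z ℤ.* b) ℤ.* a ℤ.- d
    assoc = solve-∀
    collect : ∀ i y m a d → (i ℤ.+ y ℤ.* m) ℤ.* a ℤ.- m ℤ.* d ≡ i ℤ.* a ℤ.+ m ℤ.* (y ℤ.* a ℤ.- d)
    collect = solve-∀

∣-difference⇒≡ : ∀ {m i j} → i < m → j < m → m ∣ ℤ.∣ + i ℤ.- + j ∣ → i ≡ j
∣-difference⇒≡ {m} {i} {j} i<m j<m m∣ = ℤ.+-injective (ℤ.i-j≡0⇒i≡j (+ i) (+ j) (ℤ.∣i∣≡0⇒i≡0 (small m∣ bound)))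
  where
  bound : ℤ.∣ + i ℤ.- + j ∣ < m
  bound = ℕ.≤-<-trans
    (subst (λ e → ℤ.∣ e ∣ ≤ i ⊔ j) (sym (ℤ.m-n≡m⊖n i j)) (ℤ.∣m⊝n∣≤m⊔n i j))
    (ℕ.⊔-lub i<m j<m)
  small : ∀ {d} → m ∣ d → d < m → d ≡ 0
  small {zero}  _  _   = refl
  small {suc d} m∣ d<m = contradiction m∣ (>⇒∤ d<m)

digit-unique : ∀ {a m} .{{_ : NonZero m}} → Coprime a m → ∀ {i j y y′} → i < m → j < m →
  + i ℤ.* + a ℤ.+ + m ℤ.* y ≡ + j ℤ.* + a ℤ.+ + m ℤ.* y′ → i ≡ j × y ≡ y′
digit-unique {a} {m} coprime {i} {j} {y} {y′} i<m j<m eq =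
  i≡j , ℤ.*-cancelˡ-≡ (+ m) y y′ (+-cancelˡ (+ j ℤ.* + a) _ _ (trans (cong (λ e → + e ℤ.* + a ℤ.+ + m ℤ.* y) (sym i≡j)) eq))
  where
  open ≡-Reasoning
  rearrange : ∀ i a m y j → a ℤ.* (i ℤ.- j) ≡ (i ℤ.* a ℤ.+ m ℤ.* y) ℤ.- (j ℤ.* a ℤ.+ m ℤ.* y)
  rearrange = solve-∀
  cancel : ∀ j a m y y′ → (j ℤ.* a ℤ.+ m ℤ.* y′) ℤ.- (j ℤ.* a ℤ.+ m ℤ.* y) ≡ (y′ ℤ.- y) ℤ.* m
  cancel = solve-∀
  m∣ : m ∣ a * ℤ.∣ + i ℤ.- + j ∣
  m∣ = subst (m ∣_) (ℤ.abs-* (+ a) _) (Signed.∣⇒∣ᵤ (Signed.divides (y′ ℤ.- y) (begin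
    + a ℤ.* (+ i ℤ.- + j)                                            ≡⟨ rearrange (+ i) (+ a) (+ m) y (+ j) ⟩
    (+ i ℤ.* + a ℤ.+ + m ℤ.* y) ℤ.- (+ j ℤ.* + a ℤ.+ + m ℤ.* y)      ≡⟨ cong (ℤ._- (+ j ℤ.* + a ℤ.+ + m ℤ.* y)) eq ⟩
    (+ j ℤ.* + a ℤ.+ + m ℤ.* y′) ℤ.- (+ j ℤ.* + a ℤ.+ + m ℤ.* y)     ≡⟨ cancel (+ j) (+ a) (+ m) y y′ ⟩
    (y′ ℤ.- y) ℤ.* + m                                               ∎)))
  i≡j : i ≡ j
  i≡j = ∣-difference⇒≡ i<m j<m (coprime-divisor (Coprimality.sym coprime) m∣)

indicator : ∀ {A : Set} → Dec A → ℕ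
indicator d = if does d then 1 else 0

indicator-yes : ∀ {A : Set} (d : Dec A) → A → indicator d ≡ 1
indicator-yes (yes _) _ = refl
indicator-yes (no ¬a) a = contradiction a ¬a

indicator-no : ∀ {A : Set} (d : Dec A) → ¬ A → indicator d ≡ 0
indicator-no (yes a) ¬a = contradiction a ¬a
indicator-no (no _)  _  = refl

indicator-mono : ∀ {A B : Set} (a? : Dec A) (b? : Dec B) → (A → B) → indicator a? ≤ indicator b?
indicator-mono (no _)  _  _ = z≤n
indicator-mono (yes a) b? f = ℕ.≤-reflexive (sym (indicator-yes b? (f a)))

count : ∀ {P : Pred ℕ 0ℓ} → Decidable P → ℕ → ℕ
count P? zero    = 0
count P? (suc n) = count P? n + indicator (P? n)

count-mono : ∀ {P Q : Pred ℕ 0ℓ} (P? : Decidable P) (Q? : Decidable Q) n →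
  (∀ {a} → a < n → P a → Q a) → count P? n ≤ count Q? n
count-mono P? Q? zero    _   = z≤n
count-mono P? Q? (suc n) P⊆Q = ℕ.+-mono-≤
  (count-mono P? Q? n λ a<n → P⊆Q (ℕ.m<n⇒m<1+n a<n))
  (indicator-mono (P? n) (Q? n) (P⊆Q ℕ.≤-refl))

count-none : ∀ {P : Pred ℕ 0ℓ} (P? : Decidable P) n → (∀ {a} → a < n → ¬ P a) → count P? n ≡ 0
count-none P? zero    _    = refl
count-none P? (suc n) none with P? n
... | yes Pn = contradiction Pn (none ℕ.≤-refl)
... | no _   = trans (ℕ.+-identityʳ _) (count-none P? n λ a<n → none (ℕ.m<n⇒m<1+n a<n))

module _ {P E : Pred ℕ 0ℓ} (P? : Decidable P) (E? : Decidable E) where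

  count-except : ∀ n → (∀ {a b} → a < n → b < n → P a → P b → E a → E b → a ≡ b) →
    count P? n ≤ suc (count (λ a → P? a ×-dec ¬? (E? a)) n)
  count-except zero    _      = z≤n
  count-except (suc n) unique with P? n | E? n
  ... | no _   | _      = ℕ.+-monoˡ-≤ 0 (count-except n λ a< b< → unique (ℕ.m<n⇒m<1+n a<) (ℕ.m<n⇒m<1+n b<))
  ... | yes _  | no _   = ℕ.+-monoˡ-≤ 1 (count-except n λ a< b< → unique (ℕ.m<n⇒m<1+n a<) (ℕ.m<n⇒m<1+n b<))
  ... | yes Pn | yes En = subst₂ _≤_ (ℕ.+-comm 1 _) (cong suc (sym (ℕ.+-identityʳ _)))
    (s≤s (count-mono P? _ n λ a<n Pa → Pa , λ Ea →
      contradiction (unique (ℕ.m<n⇒m<1+n a<n) ℕ.≤-refl Pa Pn Ea En) (ℕ.<⇒≢ a<n)))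

-- Induction on an upper bound h of the values of f, removing the argument where h − 1 is attained.
count-window : ∀ {P : Pred ℕ 0ℓ} (P? : Decidable P) (f : ℕ → ℕ) n g →
  (∀ {a b} → a < n → b < n → P a → P b → f a ≡ f b → a ≡ b) →
  (∀ {a b} → a < n → b < n → P a → P b → f a < f b + g) →
  ∀ h → (∀ {a} → a < n → P a → f a < h) → count P? n ≤ g
count-window P? f n g inj window zero bounded =
  ℕ.≤-trans (ℕ.≤-reflexive (count-none P? n λ a<n Pa → ℕ.n≮0 (bounded a<n Pa))) z≤n
count-window P? f n g inj window (suc h) bounded
  with ℕ.anyUpTo? (λ a → P? a ×-dec (f a ℕ.≟ h)) n
... | no none = count-window P? f n g inj window h λ a<n Pa →
  ℕ.≤∧≢⇒< (ℕ.≤-pred (bounded a<n Pa)) λ fa≡h → none (_ , a<n , Pa , fa≡h)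
... | yes (b , b<n , Pb , fb≡h) with g
... | zero = contradiction (subst (f b <_) (ℕ.+-identityʳ _) (window b<n b<n Pb Pb)) (ℕ.n≮n _)
... | suc g = ℕ.≤-trans
  (count-except P? (λ a → f a ℕ.≟ h) n λ a< b< Pa Pb fa≡h fb≡h → inj a< b< Pa Pb (trans fa≡h (sym fb≡h)))
  (s≤s (count-window (λ a → P? a ×-dec ¬? (f a ℕ.≟ h)) f n g
    (λ a< b< (Pa , _) (Pb , _) → inj a< b< Pa Pb)
    (λ {a} {c} a< c< Pa (Pc , _) → ℕ.≤-pred (ℕ.≤-<-trans (below a< Pa)
      (subst₂ _<_ fb≡h (ℕ.+-suc (f c) g) (window b<n c< Pb Pc))))
    h below))
  where
  below : ∀ {a} → a < n → _ × ¬ (f a ≡ h) → f a < h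
  below a<n (Pa , fa≢h) = ℕ.≤∧≢⇒< (ℕ.≤-pred (bounded a<n Pa)) fa≢h

∑ : (ℕ → ℤ) → ℕ → ℤ
∑ f zero    = 0ℤ
∑ f (suc n) = ∑ f n ℤ.+ f n

∑-≤-count : ∀ {P Q : Pred ℕ 0ℓ} (P? : Decidable P) (Q? : Decidable Q) (f : ℕ → ℤ) n →
  (∀ {m} → m < n → f m ℤ.≤ + (indicator (P? m) + indicator (Q? m))) →
  ∑ f n ℤ.≤ + (count P? n + count Q? n)
∑-≤-count P? Q? f zero    _  = ℤ.≤-refl
∑-≤-count P? Q? f (suc n) f≤ = ℤ.≤-trans
  (ℤ.+-mono-≤ (∑-≤-count P? Q? f n λ m<n → f≤ (ℕ.m<n⇒m<1+n m<n)) (f≤ ℕ.≤-refl))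
  (ℤ.≤-reflexive (cong +_ (interchange (count P? n) (count Q? n) (indicator (P? n)) (indicator (Q? n)))))
  where
  open import Algebra.Properties.CommutativeSemigroup ℕ.+-commutativeSemigroup using (interchange)

∑-neg : ∀ f n → ℤ.- ∑ f n ≡ ∑ (λ m → ℤ.- f m) n
∑-neg f zero    = refl
∑-neg f (suc n) = trans (ℤ.neg-distrib-+ (∑ f n) (f n)) (cong (ℤ._+ ℤ.- f n) (∑-neg f n))

Δ : ℕ → (ℤ → ℤ) → ℤ → ℤ
Δ m f z = f (z ℤ.- + m) ℤ.- f z

δ : ℤ → ℤ
δ (+ zero)  = 1ℤ
δ (+ suc _) = 0ℤ
δ -[1+ _ ]  = 0ℤ

δ≡0 : ∀ {z} → z ≢ 0ℤ → δ z ≡ 0ℤ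
δ≡0 {+ zero}   z≢0 = contradiction refl z≢0
δ≡0 {+ suc _}  _   = refl
δ≡0 { -[1+ _ ]} _   = refl

ramp : ℤ → ℤ
ramp (+ n)    = + suc n
ramp -[1+ _ ] = 0ℤ

step : ℤ → ℤ
step (+ _)    = 1ℤ
step -[1+ _ ] = 0ℤ

Δ-ramp : ∀ t → ramp (t ℤ.- 1ℤ) ℤ.- ramp t ≡ ℤ.- step t
Δ-ramp (+ zero)  = refl
Δ-ramp (+ suc n) = identity (+ suc n)
  where
  identity : ∀ n → n ℤ.- (1ℤ ℤ.+ n) ≡ -1ℤ
  identity = solve-∀
Δ-ramp -[1+ _ ]  = refl

Δ-step : ∀ t → ℤ.- step (t ℤ.- 1ℤ) ℤ.- ℤ.- step t ≡ δ t
Δ-step (+ zero)  = refl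
Δ-step (+ suc n) = refl
Δ-step -[1+ _ ]  = refl

pred-zero : ∀ n .{{_ : NonZero n}} → ∃[ m ] (m < n) × (+ m ≡ 0ℤ ℤ.+ (-1ℤ ℤ.+ 1ℤ ℤ.* + n))
pred-zero (suc m) = m , ℕ.≤-refl , identity (+ m)
  where
  identity : ∀ m → m ≡ 0ℤ ℤ.+ (-1ℤ ℤ.+ 1ℤ ℤ.* (1ℤ ℤ.+ m))
  identity = solve-∀

pred-suc : ∀ m n → + m ≡ + suc m ℤ.+ (-1ℤ ℤ.+ 0ℤ ℤ.* + n)
pred-suc m n = identity (+ m) (+ n)
  where
  identity : ∀ m n → m ≡ 1ℤ ℤ.+ m ℤ.+ (-1ℤ ℤ.+ 0ℤ ℤ.* n)
  identity = solve-∀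

predecessor : ∀ {m n} → m < n → ∃[ m′ ] ∃[ e ] (m′ < n) × (+ m′ ≡ + m ℤ.+ (-1ℤ ℤ.+ e ℤ.* + n))
predecessor {zero}  {suc n} _     = let m′ , m′<n , m′≡ = pred-zero (suc n) in m′ , 1ℤ , m′<n , m′≡
predecessor {suc m} {n}     sm<n  = m , 0ℤ , ℕ.<⇒≤ sm<n , pred-suc m n

module Representation
  (p q r : ℕ) .{{_ : NonZero p}} .{{_ : NonZero q}} .{{_ : NonZero r}}
  (qr⊥p : Coprime (q * r) p) (r⊥q : Coprime r q) where

  -- i q r + j p r + k p q + t p q r, nested so that one division with remainder splits off one digit.
  val₂ : (k t : ℤ) → ℤ
  val₂ k t = k ℤ.* 1ℤ ℤ.+ + r ℤ.* t

  val₁ : (j k t : ℤ) → ℤ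
  val₁ j k t = j ℤ.* + r ℤ.+ + q ℤ.* val₂ k t

  val : (i j k t : ℤ) → ℤ
  val i j k t = i ℤ.* (+ q ℤ.* + r) ℤ.+ + p ℤ.* val₁ j k t

  record Val (z i j k t : ℤ) : Set where
    constructor mkVal
    field
      equation : z ≡ val i j k t

  record Rep (z : ℤ) : Set where
    constructor mkRep
    field
      {i j k} : ℕ
      {t}     : ℤ
      i<p     : i < p
      j<q     : j < q
      k<r     : k < r
      isVal   : Val z (+ i) (+ j) (+ k) t

  opaque
    rep : ∀ z → Rep z
    rep z with digit-exists qr⊥p z
    ... | i , y , i<p , z≡ with digit-exists r⊥q y
    ... | j , x , j<q , y≡ with digit-exists (1-coprimeTo r) x
    ... | k , t , k<r , x≡ = mkRep i<p j<q k<r (mkVal (trans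
      (trans z≡ (cong head {y} {val₁ (+ j) (+ k) t} (trans y≡ (cong head₁ {x} {val₂ (+ k) t} x≡))))
      (cong (λ a → + i ℤ.* a ℤ.+ + p ℤ.* val₁ (+ j) (+ k) t) (ℤ.pos-* q r))))
      where
      head : ℤ → ℤ
      head e = + i ℤ.* + (q * r) ℤ.+ + p ℤ.* e
      head₁ : ℤ → ℤ
      head₁ e = + j ℤ.* + r ℤ.+ + q ℤ.* e

    val-injective : ∀ {i j k i′ j′ k′ t t′} → i < p → i′ < p → j < q → j′ < q → k < r → k′ < r →
      val (+ i) (+ j) (+ k) t ≡ val (+ i′) (+ j′) (+ k′) t′ →
      (i ≡ i′) × (j ≡ j′) × (k ≡ k′) × (t ≡ t′)
    val-injective {i} {j} {k} {i′} {j′} {k′} {t} {t′} i<p i′<p j<q j′<q k<r k′<r eq =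
      proj₁ stepᵢ , proj₁ stepⱼ , digit-unique {1} (1-coprimeTo r) {k} {k′} {t} {t′} k<r k′<r (proj₂ stepⱼ)
      where
      eq′ : + i ℤ.* + (q * r) ℤ.+ + p ℤ.* val₁ (+ j) (+ k) t ≡ + i′ ℤ.* + (q * r) ℤ.+ + p ℤ.* val₁ (+ j′) (+ k′) t′
      eq′ = subst
        (λ a → + i ℤ.* a ℤ.+ + p ℤ.* val₁ (+ j) (+ k) t ≡ + i′ ℤ.* a ℤ.+ + p ℤ.* val₁ (+ j′) (+ k′) t′)
        (sym (ℤ.pos-* q r)) eq
      stepᵢ : (i ≡ i′) × (val₁ (+ j) (+ k) t ≡ val₁ (+ j′) (+ k′) t′)
      stepᵢ = digit-unique qr⊥p {i} {i′} {val₁ (+ j) (+ k) t} {val₁ (+ j′) (+ k′) t′} i<p i′<p eq′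
      stepⱼ : (j ≡ j′) × (val₂ (+ k) t ≡ val₂ (+ k′) t′)
      stepⱼ = digit-unique r⊥q {j} {j′} {val₂ (+ k) t} {val₂ (+ k′) t′} j<q j′<q (proj₂ stepᵢ)

  shift : ∀ {z} i j k t (i′ j′ k′ t′ a b d e f g : ℤ) {s : ℤ} →
    i′ ≡ i ℤ.+ (a ℤ.+ e ℤ.* + p) → j′ ≡ j ℤ.+ (b ℤ.+ f ℤ.* + q) → k′ ≡ k ℤ.+ (d ℤ.+ g ℤ.* + r) →
    t′ ≡ t ℤ.- e ℤ.- f ℤ.- g →
    a ℤ.* (+ q ℤ.* + r) ℤ.+ b ℤ.* (+ p ℤ.* + r) ℤ.+ d ℤ.* (+ p ℤ.* + q) ≡ ℤ.- s →
    Val z i j k t → Val (z ℤ.- s) i′ j′ k′ t′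
  shift {z} i j k t _ _ _ _ a b d e f g {s} refl refl refl refl s≡ (mkVal z≡) =
    mkVal (sym (trans (identity i j k t a b d e f g (+ p) (+ q) (+ r)) (cong₂ ℤ._+_ (sym z≡) s≡)))
    where
    identity : ∀ i j k t a b d e f g p q r →
      (i ℤ.+ (a ℤ.+ e ℤ.* p)) ℤ.* (q ℤ.* r) ℤ.+
      p ℤ.* ((j ℤ.+ (b ℤ.+ f ℤ.* q)) ℤ.* r ℤ.+
      q ℤ.* ((k ℤ.+ (d ℤ.+ g ℤ.* r)) ℤ.* 1ℤ ℤ.+ r ℤ.* (t ℤ.- e ℤ.- f ℤ.- g)))
      ≡ i ℤ.* (q ℤ.* r) ℤ.+ p ℤ.* (j ℤ.* r ℤ.+ q ℤ.* (k ℤ.* 1ℤ ℤ.+ r ℤ.* t)) ℤ.+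
      (a ℤ.* (q ℤ.* r) ℤ.+ b ℤ.* (p ℤ.* r) ℤ.+ d ℤ.* (p ℤ.* q))
    identity = solve-∀

  unwrapped : ∀ x m → x ≡ x ℤ.+ (0ℤ ℤ.+ 0ℤ ℤ.* m)
  unwrapped = solve-∀

  drop-i : ∀ {z} {i} i′ e {j k t} → + i′ ≡ + i ℤ.+ (-1ℤ ℤ.+ e ℤ.* + p) →
    Val z (+ i) (+ j) (+ k) t → Val (z ℤ.- + (q * r)) (+ i′) (+ j) (+ k) (t ℤ.- e)
  drop-i {i = i} i′ e {j} {k} {t} i′≡ = shift (+ i) (+ j) (+ k) t (+ i′) (+ j) (+ k) (t ℤ.- e) -1ℤ 0ℤ 0ℤ e 0ℤ 0ℤ
    i′≡ (unwrapped (+ j) (+ q)) (unwrapped (+ k) (+ r)) (wraps t e)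
    (trans (amount (+ p) (+ q) (+ r)) (cong ℤ.-_ (sym (ℤ.pos-* q r))))
    where
    wraps : ∀ t e → t ℤ.- e ≡ t ℤ.- e ℤ.- 0ℤ ℤ.- 0ℤ
    wraps = solve-∀
    amount : ∀ p q r → -1ℤ ℤ.* (q ℤ.* r) ℤ.+ 0ℤ ℤ.* (p ℤ.* r) ℤ.+ 0ℤ ℤ.* (p ℤ.* q) ≡ ℤ.- (q ℤ.* r)
    amount = solve-∀

  drop-j : ∀ {z} {i} {j} j′ f {k t} → + j′ ≡ + j ℤ.+ (-1ℤ ℤ.+ f ℤ.* + q) →
    Val z (+ i) (+ j) (+ k) t → Val (z ℤ.- + (p * r)) (+ i) (+ j′) (+ k) (t ℤ.- f)
  drop-j {i = i} {j} j′ f {k} {t} j′≡ = shift (+ i) (+ j) (+ k) t (+ i) (+ j′) (+ k) (t ℤ.- f) 0ℤ -1ℤ 0ℤ 0ℤ f 0ℤ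
    (unwrapped (+ i) (+ p)) j′≡ (unwrapped (+ k) (+ r)) (wraps t f)
    (trans (amount (+ p) (+ q) (+ r)) (cong ℤ.-_ (sym (ℤ.pos-* p r))))
    where
    wraps : ∀ t f → t ℤ.- f ≡ t ℤ.- 0ℤ ℤ.- f ℤ.- 0ℤ
    wraps = solve-∀
    amount : ∀ p q r → 0ℤ ℤ.* (q ℤ.* r) ℤ.+ -1ℤ ℤ.* (p ℤ.* r) ℤ.+ 0ℤ ℤ.* (p ℤ.* q) ≡ ℤ.- (p ℤ.* r)
    amount = solve-∀

  drop-k : ∀ {z} {i j} {k} k′ g {t} → + k′ ≡ + k ℤ.+ (-1ℤ ℤ.+ g ℤ.* + r) →
    Val z (+ i) (+ j) (+ k) t → Val (z ℤ.- + (p * q)) (+ i) (+ j) (+ k′) (t ℤ.- g)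
  drop-k {i = i} {j} {k} k′ g {t} k′≡ = shift (+ i) (+ j) (+ k) t (+ i) (+ j) (+ k′) (t ℤ.- g) 0ℤ 0ℤ -1ℤ 0ℤ 0ℤ g
    (unwrapped (+ i) (+ p)) (unwrapped (+ j) (+ q)) k′≡ (wraps t g)
    (trans (amount (+ p) (+ q) (+ r)) (cong ℤ.-_ (sym (ℤ.pos-* p q))))
    where
    wraps : ∀ t g → t ℤ.- g ≡ t ℤ.- 0ℤ ℤ.- 0ℤ ℤ.- g
    wraps = solve-∀
    amount : ∀ p q r → 0ℤ ℤ.* (q ℤ.* r) ℤ.+ 0ℤ ℤ.* (p ℤ.* r) ℤ.+ -1ℤ ℤ.* (p ℤ.* q) ≡ ℤ.- (p ℤ.* q)
    amount = solve-∀

  -- The coefficients of (1 − Xᵖᑫʳ) / ((1 − Xᵖᑫ) (1 − Xᵖʳ) (1 − Xᑫʳ)).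
  c : ℤ → ℤ
  c z = ramp (Rep.t (rep z))

  c-val : ∀ {z i j k t} → i < p → j < q → k < r → Val z (+ i) (+ j) (+ k) t → c z ≡ ramp t
  c-val {z} i<p j<q k<r (mkVal z≡) = cong ramp
    (proj₂ (proj₂ (proj₂ (val-injective R.i<p i<p R.j<q j<q R.k<r k<r (trans (sym (Val.equation R.isVal)) z≡)))))
    where module R = Rep (rep z)

  c₁ c₂ c₃ : ℤ → ℤ
  c₁ = Δ (q * r) c
  c₂ = Δ (p * r) c₁
  c₃ = Δ (p * q) c₂

  module _ {z : ℤ} {j k : ℕ} {t : ℤ} (j<q : j < q) (k<r : k < r) where

    c₁-zero : Val z 0ℤ (+ j) (+ k) t → c₁ z ≡ ℤ.- step t
    c₁-zero z≡ with pred-zero p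
    ... | i′ , i′<p , i′≡ = trans
      (cong₂ ℤ._-_ (c-val i′<p j<q k<r (drop-i i′ 1ℤ i′≡ z≡)) (c-val (>-nonZero⁻¹ p) j<q k<r z≡))
      (Δ-ramp t)

    c₁-suc : ∀ {i} → suc i < p → Val z (+ suc i) (+ j) (+ k) t → c₁ z ≡ 0ℤ
    c₁-suc {i} si<p z≡ = ℤ.i≡j⇒i-j≡0 (trans
      (c-val (ℕ.<⇒≤ si<p) j<q k<r (drop-i i 0ℤ (pred-suc i p) z≡))
      (trans (cong ramp (ℤ.+-identityʳ t)) (sym (c-val si<p j<q k<r z≡))))

  module _ {z : ℤ} {k : ℕ} {t : ℤ} (k<r : k < r) where

    c₂-zero : Val z 0ℤ 0ℤ (+ k) t → c₂ z ≡ δ t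
    c₂-zero z≡ with pred-zero q
    ... | j′ , j′<q , j′≡ = trans
      (cong₂ ℤ._-_ (c₁-zero j′<q k<r (drop-j {i = 0} j′ 1ℤ j′≡ z≡)) (c₁-zero (>-nonZero⁻¹ q) k<r z≡))
      (Δ-step t)

    c₂-suc-j : ∀ {j} → suc j < q → Val z 0ℤ (+ suc j) (+ k) t → c₂ z ≡ 0ℤ
    c₂-suc-j {j} sj<q z≡ = ℤ.i≡j⇒i-j≡0 (trans
      (c₁-zero (ℕ.<⇒≤ sj<q) k<r (drop-j {i = 0} j 0ℤ (pred-suc j q) z≡))
      (trans (cong (λ e → ℤ.- step e) (ℤ.+-identityʳ t)) (sym (c₁-zero sj<q k<r z≡))))

    c₂-suc-i : ∀ {i j} → suc i < p → j < q → Val z (+ suc i) (+ j) (+ k) t → c₂ z ≡ 0ℤ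
    c₂-suc-i {j = j} si<p j<q z≡ with predecessor j<q
    ... | j′ , f , j′<q , j′≡ = ℤ.i≡j⇒i-j≡0 (trans
      (c₁-suc j′<q k<r si<p (drop-j j′ f j′≡ z≡))
      (sym (c₁-suc j<q k<r si<p z≡)))

  0≡val : 0ℤ ≡ val 0ℤ 0ℤ 0ℤ 0ℤ
  0≡val = identity (+ p) (+ q) (+ r)
    where
    identity : ∀ p q r → 0ℤ ≡ 0ℤ ℤ.* (q ℤ.* r) ℤ.+ p ℤ.* (0ℤ ℤ.* r ℤ.+ q ℤ.* (0ℤ ℤ.* 1ℤ ℤ.+ r ℤ.* 0ℤ))
    identity = solve-∀

  drop-t : ∀ {z} i j k t → Val z i j k t → Val (z ℤ.- + (p * q * r)) i j k (t ℤ.- 1ℤ)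
  drop-t i j k t (mkVal refl) = mkVal (trans
    (cong (ℤ._-_ (val i j k t)) (trans (ℤ.pos-* (p * q) r) (cong (ℤ._* + r) (ℤ.pos-* p q))))
    (identity i j k t (+ p) (+ q) (+ r)))
    where
    identity : ∀ i j k t p q r →
      i ℤ.* (q ℤ.* r) ℤ.+ p ℤ.* (j ℤ.* r ℤ.+ q ℤ.* (k ℤ.* 1ℤ ℤ.+ r ℤ.* t)) ℤ.- p ℤ.* q ℤ.* r
      ≡ i ℤ.* (q ℤ.* r) ℤ.+ p ℤ.* (j ℤ.* r ℤ.+ q ℤ.* (k ℤ.* 1ℤ ℤ.+ r ℤ.* (t ℤ.- 1ℤ)))
    identity = solve-∀

  δ-val : ∀ {z} i j k t → i < p → j < q → k < r → Val z (+ i) (+ j) (+ k) t →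
    z ≡ 0ℤ → (i ≡ 0) × (j ≡ 0) × (k ≡ 0) × (t ≡ 0ℤ)
  δ-val i j k t i<p j<q k<r (mkVal z≡) z≡0 = val-injective i<p (>-nonZero⁻¹ p) j<q (>-nonZero⁻¹ q) k<r (>-nonZero⁻¹ r)
    (trans (sym z≡) (trans z≡0 0≡val))

  δ-multiple : ∀ {z} t → Val z 0ℤ 0ℤ 0ℤ t → δ z ≡ δ t
  δ-multiple {z} t z≡ with t ℤ.≟ 0ℤ
  ... | yes refl = cong δ (trans (Val.equation z≡) (sym 0≡val))
  ... | no t≢0 = trans
    (δ≡0 (λ z≡0 → t≢0 (proj₂ (proj₂ (proj₂ (δ-val 0 0 0 t (>-nonZero⁻¹ p) (>-nonZero⁻¹ q) (>-nonZero⁻¹ r) z≡ z≡0))))))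
    (sym (δ≡0 t≢0))

  Δδ≡0 : ∀ {z} i j k t → i < p → j < q → k < r → Val z (+ i) (+ j) (+ k) t →
    ((i ≡ 0) × (j ≡ 0) × (k ≡ 0) → ⊥) → Δ (p * q * r) δ z ≡ 0ℤ
  Δδ≡0 i j k t i<p j<q k<r z≡ nonzero = cong₂ ℤ._-_
    (vanish (t ℤ.- 1ℤ) (drop-t (+ i) (+ j) (+ k) t z≡)) (vanish t z≡)
    where
    vanish : ∀ {z} t → Val z (+ i) (+ j) (+ k) t → δ z ≡ 0ℤ
    vanish t z≡ = δ≡0 λ z≡0 → let i≡0 , j≡0 , k≡0 , _ = δ-val i j k t i<p j<q k<r z≡ z≡0 in nonzero (i≡0 , j≡0 , k≡0)

  c₃-val : ∀ {z} i j k t → i < p → j < q → k < r → Val z (+ i) (+ j) (+ k) t → c₃ z ≡ Δ (p * q * r) δ z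
  c₃-val zero zero zero t _ _ k<r z≡ with pred-zero r
  ... | k′ , k′<r , k′≡ = cong₂ ℤ._-_
    (trans (c₂-zero k′<r (drop-k {i = 0} {0} k′ 1ℤ k′≡ z≡)) (sym (δ-multiple (t ℤ.- 1ℤ) (drop-t 0ℤ 0ℤ 0ℤ t z≡))))
    (trans (c₂-zero k<r z≡) (sym (δ-multiple t z≡)))
  c₃-val zero zero (suc k) t i<p j<q sk<r z≡ = trans
    (ℤ.i≡j⇒i-j≡0 (trans (c₂-zero (ℕ.<⇒≤ sk<r) (drop-k {i = 0} {0} k 0ℤ (pred-suc k r) z≡))
      (trans (cong δ (ℤ.+-identityʳ t)) (sym (c₂-zero sk<r z≡)))))
    (sym (Δδ≡0 0 0 (suc k) t i<p j<q sk<r z≡ λ ()))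
  c₃-val zero (suc j) k t i<p sj<q k<r z≡ with predecessor k<r
  ... | k′ , g , k′<r , k′≡ = trans
    (cong₂ ℤ._-_ (c₂-suc-j k′<r sj<q (drop-k {i = 0} k′ g k′≡ z≡)) (c₂-suc-j k<r sj<q z≡))
    (sym (Δδ≡0 0 (suc j) k t i<p sj<q k<r z≡ λ ()))
  c₃-val (suc i) j k t si<p j<q k<r z≡ with predecessor k<r
  ... | k′ , g , k′<r , k′≡ = trans
    (cong₂ ℤ._-_ (c₂-suc-i k′<r si<p j<q (drop-k k′ g k′≡ z≡)) (c₂-suc-i k<r si<p j<q z≡))
    (sym (Δδ≡0 (suc i) j k t si<p j<q k<r z≡ λ ()))

  Δ-c : ∀ z → c₃ z ≡ Δ (p * q * r) δ z
  Δ-c z = c₃-val R.i R.j R.k R.t R.i<p R.j<q R.k<r R.isVal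
    where module R = Rep (rep z)

bit : Bool → ℤ
bit b = + (if b then 1 else 0)

-- If z has coordinate t, then z − r, z − q and z − q − r have coordinates t₁, t₂ and t₃: e₁, e₂, e₂ + e₃ count the borrows
-- of the digit i, and f, h tell whether the digits j, k carry.
module _ (e₁ e₂ e₃ : ℤ) (t : ℤ) (f h : Bool) where

  t₁ t₂ t₃ : ℤ
  t₁ = t ℤ.- e₁ ℤ.+ bit f
  t₂ = t ℤ.- e₂ ℤ.+ bit h
  t₃ = t₂ ℤ.- e₃ ℤ.+ bit f

  corner : ℤ
  corner = (ramp t₃ ℤ.- ramp t₂) ℤ.- (ramp t₁ ℤ.- ramp t)

  Admissible : Set
  Admissible = t ℤ.≤ 0ℤ × t₁ ℤ.≤ 0ℤ × t₂ ℤ.≤ 0ℤ × t₃ ℤ.≤ 0ℤ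

  admissible? : Dec Admissible
  admissible? = (t ℤ.≤? 0ℤ) ×-dec (t₁ ℤ.≤? 0ℤ) ×-dec (t₂ ℤ.≤? 0ℤ) ×-dec (t₃ ℤ.≤? 0ℤ)

Cell : ℤ → Bool → Bool → ℤ → Bool → Bool → Set
Cell t₀ f₀ h₀ t f h = t ≡ t₀ × f ≡ f₀ × h ≡ h₀

cell? : ∀ t₀ f₀ h₀ t f h → Dec (Cell t₀ f₀ h₀ t f h)
cell? t₀ f₀ h₀ t f h = (t ℤ.≟ t₀) ×-dec (f 𝔹.≟ f₀) ×-dec (h 𝔹.≟ h₀)

Bound : Set
Bound = ℤ → Bool → Bool → ℕ

module _ (e₁ e₂ e₃ : ℤ) (upper lower : Bound) where

  Bounded : ℤ → Bool → Bool → Set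
  Bounded t f h = Admissible e₁ e₂ e₃ t f h →
    corner e₁ e₂ e₃ t f h ℤ.≤ + upper t f h × ℤ.- corner e₁ e₂ e₃ t f h ℤ.≤ + lower t f h

  bounded? : ∀ t f h → Dec (Bounded t f h)
  bounded? t f h = admissible? e₁ e₂ e₃ t f h →-dec
    ((corner e₁ e₂ e₃ t f h ℤ.≤? + upper t f h) ×-dec (ℤ.- corner e₁ e₂ e₃ t f h ℤ.≤? + lower t f h))

  Check : ℤ → Set
  Check t = True (bounded? t true true ×-dec bounded? t true false ×-dec bounded? t false true ×-dec bounded? t false false)

  sound : (∀ t → Check t) → ∀ t f h → Bounded t f h
  sound check t f h with toWitness (check t)
  sound check t true  true  | b , _         = b
  sound check t true  false | _ , b , _     = b
  sound check t false true  | _ , _ , b , _ = b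
  sound check t false false | _ , _ , _ , b = b

constant : ℕ → Bound
constant n _ _ _ = n

within : ℤ → Bool → Bool → Bound
within t₀ f₀ h₀ t f h = indicator (cell? t₀ f₀ h₀ t f h)

-- The subscripts are e₁, e₂ and e₃.
zone₀₀₀ : ∀ t f h → Bounded 0ℤ 0ℤ 0ℤ (within -[1+ 1 ] true true) (constant 0) t f h
zone₀₀₀ = sound 0ℤ 0ℤ 0ℤ (within -[1+ 1 ] true true) (constant 0) λ where
  (+ zero)             → tt
  (+ suc _)            → tt
  -[1+ 0 ]             → tt
  -[1+ 1 ]             → tt
  -[1+ suc (suc _) ]   → tt

zone₀₀₁ : ∀ t f h → Bounded 0ℤ 0ℤ 1ℤ (constant 0) (constant 1) t f h
zone₀₀₁ = sound 0ℤ 0ℤ 1ℤ (constant 0) (constant 1) λ where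
  (+ zero)             → tt
  (+ suc _)            → tt
  -[1+ 0 ]             → tt
  -[1+ 1 ]             → tt
  -[1+ suc (suc _) ]   → tt

zone₀₁₀ : ∀ t f h → Bounded 0ℤ 1ℤ 0ℤ (constant 0) (within -1ℤ true false) t f h
zone₀₁₀ = sound 0ℤ 1ℤ 0ℤ (constant 0) (within -1ℤ true false) λ where
  (+ zero)             → tt
  (+ suc _)            → tt
  -[1+ 0 ]             → tt
  -[1+ 1 ]             → tt
  -[1+ suc (suc _) ]   → tt

zone₁₁₀ : ∀ t f h → Bounded 1ℤ 1ℤ 0ℤ (constant 1) (constant 0) t f h
zone₁₁₀ = sound 1ℤ 1ℤ 0ℤ (constant 1) (constant 0) λ where
  (+ zero)             → tt
  (+ suc _)            → tt
  -[1+ 0 ]             → tt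
  -[1+ 1 ]             → tt
  -[1+ suc (suc _) ]   → tt

zone₁₁₁ : ∀ t f h → Bounded 1ℤ 1ℤ 1ℤ (within 0ℤ false false) (constant 0) t f h
zone₁₁₁ = sound 1ℤ 1ℤ 1ℤ (within 0ℤ false false) (constant 0) λ where
  (+ zero)             → tt
  (+ suc _)            → tt
  -[1+ 0 ]             → tt
  -[1+ 1 ]             → tt
  -[1+ suc (suc _) ]   → tt

pos-∸ : ∀ {m n} → n ≤ m → + (m ∸ n) ≡ + m ℤ.- + n
pos-∸ {m} {n} n≤m = trans (sym (ℤ.⊖-≥ n≤m)) (sym (ℤ.m-n≡m⊖n m n))

lower-digit : ∀ {i u} p → u ≤ i → + (i ∸ u) ≡ + i ℤ.+ (ℤ.- + u ℤ.+ 0ℤ ℤ.* + p)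
lower-digit {i} {u} p u≤i = trans (pos-∸ u≤i) (identity (+ i) (+ u) (+ p))
  where
  identity : ∀ i u p → i ℤ.- u ≡ i ℤ.+ (ℤ.- u ℤ.+ 0ℤ ℤ.* p)
  identity = solve-∀

borrow-digit : ∀ i {u p} → u ≤ p → + (i + p ∸ u) ≡ + i ℤ.+ (ℤ.- + u ℤ.+ 1ℤ ℤ.* + p)
borrow-digit i {u} {p} u≤p = trans (pos-∸ (ℕ.≤-trans u≤p (ℕ.m≤n+m p i)))
  (trans (cong (ℤ._- + u) (ℤ.pos-+ i p)) (identity (+ i) (+ u) (+ p)))
  where
  identity : ∀ i u p → i ℤ.+ p ℤ.- u ≡ i ℤ.+ (ℤ.- u ℤ.+ 1ℤ ℤ.* p)
  identity = solve-∀

borrow-digit< : ∀ {i u p} → i < u → u ≤ p → i + p ∸ u < p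
borrow-digit< {i} {u} {p} i<u u≤p = ℕ.+-cancelʳ-< u _ _ (begin-strict
  (i + p ∸ u) + u  ≡⟨ ℕ.m∸n+n≡m (ℕ.≤-trans u≤p (ℕ.m≤n+m p i)) ⟩
  i + p            <⟨ ℕ.+-monoˡ-< p i<u ⟩
  u + p            ≡⟨ ℕ.+-comm u p ⟩
  p + u            ∎)
  where open ℕ.≤-Reasoning

wraps : ℕ → ℕ → ℕ → Bool
wraps q w j = q ≤ᵇ (j + w)

raise-digit : ∀ {j q w} → j < q → w < q →
  ∃[ j′ ] j′ < q × + j′ ≡ + j ℤ.+ (+ w ℤ.+ ℤ.- bit (wraps q w j) ℤ.* + q)
raise-digit {j} {q} {w} j<q w<q with q ≤ᵇ (j + w) | ℕ.≤ᵇ-reflects-≤ q (j + w)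
... | true  | ofʸ q≤ = j + w ∸ q , fits , trans (pos-∸ q≤) (trans (cong (ℤ._- + q) (ℤ.pos-+ j w)) (identity (+ j) (+ w) (+ q)))
  where
  identity : ∀ j w q → j ℤ.+ w ℤ.- q ≡ j ℤ.+ (w ℤ.+ -1ℤ ℤ.* q)
  identity = solve-∀
  fits : j + w ∸ q < q
  fits = ℕ.+-cancelʳ-< q _ _ (subst (_< q + q) (sym (ℕ.m∸n+n≡m q≤)) (ℕ.+-mono-< j<q w<q))
... | false | ofⁿ q≰ = j + w , ℕ.≰⇒> q≰ , trans (ℤ.pos-+ j w) (identity (+ j) (+ w) (+ q))
  where
  identity : ∀ j w q → j ℤ.+ w ≡ j ℤ.+ (w ℤ.+ 0ℤ ℤ.* q)
  identity = solve-∀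

-- Since q u + p (q − w) ≡ 1 modulo p q, the inverse of p modulo q is q − w: replacing j by j + w is subtracting it.
module Inverse {p q u w : ℕ} (1<p : 1 < p) (0<q : 0 < q) (u<p : u < p) (qu≡1+pw : q * u ≡ 1 + p * w) where

  w<q : w < q
  w<q = ℕ.*-cancelˡ-< p w q (begin-strict
    p * w      <⟨ ℕ.≤-refl ⟩
    1 + p * w  ≡⟨ qu≡1+pw ⟨
    q * u      ≤⟨ ℕ.*-monoʳ-≤ q (ℕ.<⇒≤ u<p) ⟩
    q * p      ≡⟨ ℕ.*-comm q p ⟩
    p * q      ∎)
    where open ℕ.≤-Reasoning

  spread : Bool → ℕ
  spread true  = u
  spread false = p ∸ u

  spread-bound : ∀ {i j b} → i < q → j < q → wraps q w i ≡ b → wraps q w j ≡ b →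
    p * i + 1 ≤ p * j + q * spread b
  spread-bound {i} {j} {true} i<q j<q _ wraps-j = begin
    p * i + 1            ≤⟨ ℕ.+-monoˡ-≤ 1 (ℕ.*-monoʳ-≤ p (ℕ.<⇒≤ i<q)) ⟩
    p * q + 1            ≤⟨ ℕ.+-monoˡ-≤ 1 (ℕ.*-monoʳ-≤ p q≤j+w) ⟩
    p * (j + w) + 1      ≡⟨ cong (_+ 1) (ℕ.*-distribˡ-+ p j w) ⟩
    p * j + p * w + 1    ≡⟨ ℕ.+-assoc (p * j) (p * w) 1 ⟩
    p * j + (p * w + 1)  ≡⟨ cong (_+_ (p * j)) (trans (ℕ.+-comm (p * w) 1) (sym qu≡1+pw)) ⟩
    p * j + q * u        ∎
    where
    open ℕ.≤-Reasoning
    q≤j+w : q ≤ j + w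
    q≤j+w = ℕ.≤ᵇ⇒≤ q (j + w) (subst T (sym wraps-j) _)
  spread-bound {i} {j} {false} i<q j<q wraps-i _ = ℕ.≤-trans (ℕ.+-cancelʳ-≤ (p * w + 1) _ _ (begin
    p * i + 1 + (p * w + 1)          ≡⟨ ℕ.+-assoc (p * i) 1 _ ⟩
    p * i + suc (p * w + 1)          ≡⟨ cong (_+_ (p * i)) (ℕ.+-suc (p * w) 1) ⟨
    p * i + (p * w + 2)              ≤⟨ ℕ.+-monoʳ-≤ (p * i) (ℕ.+-monoʳ-≤ (p * w) 1<p) ⟩
    p * i + (p * w + p)              ≡⟨ cong (_+_ (p * i)) (trans (ℕ.+-comm (p * w) p) (sym (ℕ.*-suc p w))) ⟩
    p * i + p * suc w                ≡⟨ ℕ.*-distribˡ-+ p i (suc w) ⟨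
    p * (i + suc w)                  ≤⟨ ℕ.*-monoʳ-≤ p i+w<q ⟩
    p * q                            ≡⟨ ℕ.*-comm p q ⟩
    q * p                            ≡⟨ cong (q *_) (ℕ.m∸n+n≡m (ℕ.<⇒≤ u<p)) ⟨
    q * (p ∸ u + u)                  ≡⟨ ℕ.*-distribˡ-+ q (p ∸ u) u ⟩
    q * (p ∸ u) + q * u              ≡⟨ cong (_+_ (q * (p ∸ u))) (trans qu≡1+pw (ℕ.+-comm 1 (p * w))) ⟩
    q * (p ∸ u) + (p * w + 1)        ∎)) (ℕ.m≤n+m _ (p * j))
    where
    open ℕ.≤-Reasoning
    i+w<q : i + suc w ≤ q
    i+w<q = subst (_≤ q) (sym (ℕ.+-suc i w)) (ℕ.≰⇒> λ q≤ → subst T wraps-i (ℕ.≤⇒≤ᵇ q≤))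

  inverseℤ : + q ℤ.* + u ≡ 1ℤ ℤ.+ + p ℤ.* + w
  inverseℤ = trans (sym (ℤ.pos-* q u)) (trans (cong +_ qu≡1+pw) (cong (ℤ._+_ 1ℤ) (ℤ.pos-* p w)))

InRange : ℕ → ℕ → ℕ → Set
InRange lo hi i = lo ≤ i × i < hi

inRange? : ∀ lo hi i → Dec (InRange lo hi i)
inRange? lo hi i = (lo ℕ.≤? i) ×-dec (i ℕ.<? hi)

module _ {A B C : Set} {y : ℤ} (a? : Dec A) (b? : Dec B) (c? : Dec C) where

  by-none : y ℤ.≤ 0ℤ → y ℤ.≤ + (indicator a? + indicator (b? ×-dec c?))
  by-none y≤0 = ℤ.≤-trans y≤0 (ℤ.+≤+ z≤n)

  by-first : A → y ℤ.≤ 1ℤ → y ℤ.≤ + (indicator a? + indicator (b? ×-dec c?))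
  by-first a y≤1 = ℤ.≤-trans y≤1 (ℤ.+≤+ (ℕ.≤-trans (ℕ.≤-reflexive (sym (indicator-yes a? a))) (ℕ.m≤m+n _ _)))

  by-second : B → y ℤ.≤ + indicator c? → y ℤ.≤ + (indicator a? + indicator (b? ×-dec c?))
  by-second b y≤c = ℤ.≤-trans y≤c (ℤ.+≤+ (ℕ.≤-trans (indicator-mono c? (b? ×-dec c?) (b ,_)) (ℕ.m≤n+m _ _)))

module Coefficient
  (p q r : ℕ) .{{_ : NonZero p}} .{{_ : NonZero q}} .{{_ : NonZero r}}
  (qr⊥p : Coprime (q * r) p) (r⊥q : Coprime r q)
  (1<p : 1 < p) (p<q : p < q) (p<r : p < r)
  {u v w x : ℕ} (u<p : u < p) (v<p : v < p)
  (qu≡1+pw : q * u ≡ 1 + p * w) (rv≡1+px : r * v ≡ 1 + p * x) where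

  open Representation p q r qr⊥p r⊥q public
  private
    module Q = Inverse 1<p (ℕ.<-trans (ℕ.<-trans (s≤s z≤n) 1<p) p<q) u<p qu≡1+pw
    module R = Inverse 1<p (ℕ.<-trans (ℕ.<-trans (s≤s z≤n) 1<p) p<r) v<p rv≡1+px

  a : ℤ → ℤ
  a z = ∑ (λ m → Δ q (Δ r c) (z ℤ.- + m)) p

  drop-r : ∀ {z i} j k t i′ e → j < q → + i′ ≡ + i ℤ.+ (ℤ.- + u ℤ.+ e ℤ.* + p) → Val z (+ i) (+ j) (+ k) t →
    ∃[ j′ ] j′ < q × Val (z ℤ.- + r) (+ i′) (+ j′) (+ k) (t ℤ.- e ℤ.+ bit (wraps q w j))
  drop-r {z} {i} j k t i′ e j<q i′≡ isVal with raise-digit j<q Q.w<q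
  ... | j′ , j′<q , j′≡ = j′ , j′<q , shift (+ i) (+ j) (+ k) t (+ i′) (+ j′) (+ k) _
    (ℤ.- + u) (+ w) 0ℤ e (ℤ.- bit (wraps q w j)) 0ℤ i′≡ j′≡ (unwrapped (+ k) (+ r))
    (carry t e (bit (wraps q w j)))
    (trans (amount (+ p) (+ q) (+ r) (+ u) (+ w)) (trans
      (cong (λ e → (1ℤ ℤ.+ + p ℤ.* + w ℤ.- e) ℤ.* + r ℤ.- + r) Q.inverseℤ) (cancel (+ p ℤ.* + w) (+ r)))) isVal
    where
    carry : ∀ t e f → t ℤ.- e ℤ.+ f ≡ t ℤ.- e ℤ.- ℤ.- f ℤ.- 0ℤ
    carry = solve-∀
    amount : ∀ p q r u w → ℤ.- u ℤ.* (q ℤ.* r) ℤ.+ w ℤ.* (p ℤ.* r) ℤ.+ 0ℤ ℤ.* (p ℤ.* q) ≡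
      (1ℤ ℤ.+ p ℤ.* w ℤ.- q ℤ.* u) ℤ.* r ℤ.- r
    amount = solve-∀
    cancel : ∀ a r → (1ℤ ℤ.+ a ℤ.- (1ℤ ℤ.+ a)) ℤ.* r ℤ.- r ≡ ℤ.- r
    cancel = solve-∀

  drop-q : ∀ {z i} j k t i′ e → k < r → + i′ ≡ + i ℤ.+ (ℤ.- + v ℤ.+ e ℤ.* + p) → Val z (+ i) (+ j) (+ k) t →
    ∃[ k′ ] k′ < r × Val (z ℤ.- + q) (+ i′) (+ j) (+ k′) (t ℤ.- e ℤ.+ bit (wraps r x k))
  drop-q {z} {i} j k t i′ e k<r i′≡ isVal with raise-digit k<r R.w<q
  ... | k′ , k′<r , k′≡ = k′ , k′<r , shift (+ i) (+ j) (+ k) t (+ i′) (+ j) (+ k′) _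
    (ℤ.- + v) 0ℤ (+ x) e 0ℤ (ℤ.- bit (wraps r x k)) i′≡ (unwrapped (+ j) (+ q)) k′≡
    (carry t e (bit (wraps r x k)))
    (trans (amount (+ p) (+ q) (+ r) (+ v) (+ x)) (trans
      (cong (λ e → (1ℤ ℤ.+ + p ℤ.* + x ℤ.- e) ℤ.* + q ℤ.- + q) R.inverseℤ) (cancel (+ p ℤ.* + x) (+ q)))) isVal
    where
    carry : ∀ t e f → t ℤ.- e ℤ.+ f ≡ t ℤ.- e ℤ.- 0ℤ ℤ.- ℤ.- f
    carry = solve-∀
    amount : ∀ p q r v x → ℤ.- v ℤ.* (q ℤ.* r) ℤ.+ 0ℤ ℤ.* (p ℤ.* r) ℤ.+ x ℤ.* (p ℤ.* q) ≡
      (1ℤ ℤ.+ p ℤ.* x ℤ.- r ℤ.* v) ℤ.* q ℤ.- q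
    amount = solve-∀
    cancel : ∀ a r → (1ℤ ℤ.+ a ℤ.- (1ℤ ℤ.+ a)) ℤ.* r ℤ.- r ≡ ℤ.- r
    cancel = solve-∀

  natVal : ℕ → ℕ → ℕ → ℕ
  natVal i j k = i * (q * r) + j * (p * r) + k * (p * q)

  val-natVal : ∀ i j k t → val (+ i) (+ j) (+ k) t ≡ + natVal i j k ℤ.+ t ℤ.* (+ p ℤ.* (+ q ℤ.* + r))
  val-natVal i j k t = trans (identity (+ i) (+ j) (+ k) t (+ p) (+ q) (+ r))
    (cong (ℤ._+ t ℤ.* (+ p ℤ.* (+ q ℤ.* + r))) (sym (trans (ℤ.pos-+ (i * (q * r) + j * (p * r)) _)
      (cong₂ ℤ._+_ (trans (ℤ.pos-+ (i * (q * r)) _) (cong₂ ℤ._+_ (pos-*-* i q r) (pos-*-* j p r))) (pos-*-* k p q)))))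
    where
    pos-*-* : ∀ i q r → + (i * (q * r)) ≡ + i ℤ.* (+ q ℤ.* + r)
    pos-*-* i q r = trans (ℤ.pos-* i (q * r)) (cong (+ i ℤ.*_) (ℤ.pos-* q r))
    identity : ∀ i j k t p q r →
      i ℤ.* (q ℤ.* r) ℤ.+ p ℤ.* (j ℤ.* r ℤ.+ q ℤ.* (k ℤ.* 1ℤ ℤ.+ r ℤ.* t))
      ≡ i ℤ.* (q ℤ.* r) ℤ.+ j ℤ.* (p ℤ.* r) ℤ.+ k ℤ.* (p ℤ.* q) ℤ.+ t ℤ.* (p ℤ.* (q ℤ.* r))
    identity = solve-∀

  val-pos : ∀ i j k t → val (+ i) (+ j) (+ k) (+ t) ≡ + (natVal i j k + t * (p * (q * r)))
  val-pos i j k t = trans (val-natVal i j k (+ t)) (trans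
    (cong (λ y → + natVal i j k ℤ.+ y) (sym pos-multiple))
    (sym (ℤ.pos-+ (natVal i j k) (t * (p * (q * r))))))
    where
    pos-multiple : + (t * (p * (q * r))) ≡ + t ℤ.* (+ p ℤ.* (+ q ℤ.* + r))
    pos-multiple = trans (ℤ.pos-* t (p * (q * r)))
      (cong (+ t ℤ.*_) (trans (ℤ.pos-* p (q * r)) (cong (+ p ℤ.*_) (ℤ.pos-* q r))))

  t≤0 : ∀ {z i j k t} → Val z (+ i) (+ j) (+ k) t → z ℤ.< + (p * q * r) → t ℤ.≤ 0ℤ
  t≤0 {t = + zero}   _ _ = ℤ.≤-refl
  t≤0 {t = -[1+ _ ]} _ _ = ℤ.-≤+
  t≤0 {z} {i} {j} {k} {t = + suc t} (mkVal z≡) z<N = contradiction z<N (ℤ.≤⇒≯ (begin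
    + (p * q * r)                                  ≡⟨ cong +_ (ℕ.*-assoc p q r) ⟩
    + (p * (q * r))                                ≤⟨ +≤+ (ℕ.≤-trans (ℕ.m≤m+n (p * (q * r)) (t * (p * (q * r))))
                                                      (ℕ.m≤n+m (suc t * (p * (q * r))) (natVal i j k))) ⟩
    + (natVal i j k + suc t * (p * (q * r)))       ≡⟨ val-pos i j k (suc t) ⟨
    val (+ i) (+ j) (+ k) (+ suc t)                ≡⟨ z≡ ⟨
    z                                              ∎))
    where open ℤ.≤-Reasoning

  Δ-corner : ∀ {z i j k t} i₁ i₂ i₃ e₁ e₂ e₃ → i < p → j < q → k < r →
    i₁ < p → i₂ < p → i₃ < p →
    + i₁ ≡ + i ℤ.+ (ℤ.- + u ℤ.+ e₁ ℤ.* + p) →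
    + i₂ ≡ + i ℤ.+ (ℤ.- + v ℤ.+ e₂ ℤ.* + p) →
    + i₃ ≡ + i₂ ℤ.+ (ℤ.- + u ℤ.+ e₃ ℤ.* + p) →
    Val z (+ i) (+ j) (+ k) t → z ℤ.< + (p * q * r) →
    Δ q (Δ r c) z ≡ corner e₁ e₂ e₃ t (wraps q w j) (wraps r x k) ×
    Admissible e₁ e₂ e₃ t (wraps q w j) (wraps r x k)
  Δ-corner {z} {i} {j} {k} {t} i₁ i₂ i₃ e₁ e₂ e₃ i<p j<q k<r i₁<p i₂<p i₃<p i₁≡ i₂≡ i₃≡ isVal z<N =
    let j₁ , j₁<q , isVal₁ = step₁
        k₂ , k₂<r , isVal₂ = step₂
        j₃ , j₃<q , isVal₃ = step₃
    in cong₂ ℤ._-_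
      (cong₂ ℤ._-_ (c-val i₃<p j₃<q k₂<r isVal₃) (c-val i₂<p j<q k₂<r isVal₂))
      (cong₂ ℤ._-_ (c-val i₁<p j₁<q k<r isVal₁) (c-val i<p j<q k<r isVal)) ,
    (t≤0 isVal z<N , t≤0 isVal₁ (below r z<N) , t≤0 isVal₂ (below q z<N) , t≤0 isVal₃ (below r (below q z<N)))
    where
    f h : Bool
    f = wraps q w j
    h = wraps r x k
    step₁ : ∃[ j₁ ] j₁ < q × Val (z ℤ.- + r) (+ i₁) (+ j₁) (+ k) (t₁ e₁ e₂ e₃ t f h)
    step₁ = drop-r j k t i₁ e₁ j<q i₁≡ isVal
    step₂ : ∃[ k₂ ] k₂ < r × Val (z ℤ.- + q) (+ i₂) (+ j) (+ k₂) (t₂ e₁ e₂ e₃ t f h)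
    step₂ = drop-q j k t i₂ e₂ k<r i₂≡ isVal
    step₃ : ∃[ j₃ ] j₃ < q × Val (z ℤ.- + q ℤ.- + r) (+ i₃) (+ j₃) (+ proj₁ step₂) (t₃ e₁ e₂ e₃ t f h)
    step₃ = drop-r j (proj₁ step₂) (t₂ e₁ e₂ e₃ t f h) i₃ e₃ j<q i₃≡ (proj₂ (proj₂ step₂))
    below : ∀ {z} m → z ℤ.< + (p * q * r) → z ℤ.- + m ℤ.< + (p * q * r)
    below {z} m = ℤ.≤-<-trans (ℤ.i-j≤i z (+ m))

  c-negative : ∀ {z} → z ℤ.< 0ℤ → c z ≡ 0ℤ
  c-negative {z} z<0 with rep z
  ... | mkRep {t = -[1+ _ ]} _ _ _ _ = refl
  ... | mkRep {i} {j} {k} {+ t} _ _ _ (mkVal z≡) =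
    contradiction (subst (ℤ._< 0ℤ) (trans z≡ (val-pos i j k t)) z<0) λ { (+<+ ()) }

  a-negative : ∀ {z} → z ℤ.< 0ℤ → a z ≡ 0ℤ
  a-negative {z} z<0 = ∑-zero p
    where
    below : ∀ {z} m → z ℤ.< 0ℤ → z ℤ.- + m ℤ.< 0ℤ
    below {z} m = ℤ.≤-<-trans (ℤ.i-j≤i z (+ m))
    summand≡0 : ∀ {z} → z ℤ.< 0ℤ → Δ q (Δ r c) z ≡ 0ℤ
    summand≡0 z<0 = cong₂ ℤ._-_
      (cong₂ ℤ._-_ (c-negative (below r (below q z<0))) (c-negative (below q z<0)))
      (cong₂ ℤ._-_ (c-negative (below r z<0)) (c-negative z<0))
    ∑-zero : ∀ n → ∑ (λ m → Δ q (Δ r c) (z ℤ.- + m)) n ≡ 0ℤ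
    ∑-zero zero    = refl
    ∑-zero (suc n) = cong₂ ℤ._+_ (∑-zero n) (summand≡0 (below n z<0))

  Δ-a : ∀ z → Δ 1 a z ≡ Δ p (Δ q (Δ r c)) z
  Δ-a z = telescope (Δ q (Δ r c)) p
    where
    open ≡-Reasoning
    telescope : ∀ (f : ℤ → ℤ) n → ∑ (λ m → f (z ℤ.- 1ℤ ℤ.- + m)) n ℤ.- ∑ (λ m → f (z ℤ.- + m)) n ≡ Δ n f z
    telescope f zero    = sym (ℤ.i≡j⇒i-j≡0 (cong f (ℤ.+-identityʳ z)))
    telescope f (suc n) = begin
      ∑f′ ℤ.+ f (z ℤ.- 1ℤ ℤ.- + n) ℤ.- (∑f ℤ.+ f (z ℤ.- + n))              ≡⟨ regroup ∑f′ (f (z ℤ.- 1ℤ ℤ.- + n)) ∑f (f (z ℤ.- + n)) ⟩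
      (∑f′ ℤ.- ∑f) ℤ.+ (f (z ℤ.- 1ℤ ℤ.- + n) ℤ.- f (z ℤ.- + n))            ≡⟨ cong (ℤ._+ (f (z ℤ.- 1ℤ ℤ.- + n) ℤ.- f (z ℤ.- + n))) (telescope f n) ⟩
      (f (z ℤ.- + n) ℤ.- f z) ℤ.+ (f (z ℤ.- 1ℤ ℤ.- + n) ℤ.- f (z ℤ.- + n)) ≡⟨ cancel (f (z ℤ.- + n)) (f z) (f (z ℤ.- 1ℤ ℤ.- + n)) ⟩
      f (z ℤ.- 1ℤ ℤ.- + n) ℤ.- f z                                         ≡⟨ cong (λ y → f y ℤ.- f z) (shifted z (+ n)) ⟩
      f (z ℤ.- + suc n) ℤ.- f z                                            ∎
      where
      ∑f ∑f′ : ℤ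
      ∑f  = ∑ (λ m → f (z ℤ.- + m)) n
      ∑f′ = ∑ (λ m → f (z ℤ.- 1ℤ ℤ.- + m)) n
      regroup : ∀ a b c d → a ℤ.+ b ℤ.- (c ℤ.+ d) ≡ (a ℤ.- c) ℤ.+ (b ℤ.- d)
      regroup = solve-∀
      cancel : ∀ a b c → (a ℤ.- b) ℤ.+ (c ℤ.- a) ≡ c ℤ.- b
      cancel = solve-∀
      shifted : ∀ z n → z ℤ.- 1ℤ ℤ.- n ≡ z ℤ.- (1ℤ ℤ.+ n)
      shifted = solve-∀

  module _ {z : ℤ} where

    injective-i : ∀ {i j k t i′ j′ k′ t′ m m′} → m < p → m′ < p →
      Val (z ℤ.- + m) (+ i) (+ j) (+ k) t → Val (z ℤ.- + m′) (+ i′) (+ j′) (+ k′) t′ → i ≡ i′ → m ≡ m′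
    injective-i {i} {j} {k} {t} {_} {j′} {k′} {t′} {m} {m′} m<p m′<p (mkVal eq) (mkVal eq′) refl =
      ∣-difference⇒≡ m<p m′<p (Signed.∣⇒∣ᵤ (Signed.divides (val₁ (+ j′) (+ k′) t′ ℤ.- val₁ (+ j) (+ k) t) (begin
        + m ℤ.- + m′                                       ≡⟨ difference z (+ m) (+ m′) ⟩
        (z ℤ.- + m′) ℤ.- (z ℤ.- + m)                       ≡⟨ cong₂ ℤ._-_ eq′ eq ⟩
        val (+ i) (+ j′) (+ k′) t′ ℤ.- val (+ i) (+ j) (+ k) t  ≡⟨ cancel (+ i ℤ.* (+ q ℤ.* + r)) (+ p) (val₁ (+ j) (+ k) t) (val₁ (+ j′) (+ k′) t′) ⟩
        (val₁ (+ j′) (+ k′) t′ ℤ.- val₁ (+ j) (+ k) t) ℤ.* + p ∎)))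
      where
      open ≡-Reasoning
      difference : ∀ z m m′ → m ℤ.- m′ ≡ (z ℤ.- m′) ℤ.- (z ℤ.- m)
      difference = solve-∀
      cancel : ∀ a p y y′ → a ℤ.+ p ℤ.* y′ ℤ.- (a ℤ.+ p ℤ.* y) ≡ (y′ ℤ.- y) ℤ.* p
      cancel = solve-∀

    -- The values z − m differ by less than p, while a cell confines p j to an interval of length q · Q.spread f₀
    -- and p k to one of length r · R.spread h₀.
    cell-window : ∀ {i j k t i′ j′ k′ t′ m m′} t₀ f₀ h₀ → m < p → m′ < p →
      j < q → j′ < q → k < r → k′ < r →
      Val (z ℤ.- + m) (+ i) (+ j) (+ k) t → Val (z ℤ.- + m′) (+ i′) (+ j′) (+ k′) t′ →
      Cell t₀ f₀ h₀ t (wraps q w j) (wraps r x k) → Cell t₀ f₀ h₀ t′ (wraps q w j′) (wraps r x k′) →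
      i < i′ + (Q.spread f₀ + R.spread h₀)
    cell-window {i} {j} {k} {_} {i′} {j′} {k′} {_} {m} {m′} t f₀ h₀ m<p m′<p j<q j′<q k<r k′<r
      (mkVal eq) (mkVal eq′) (refl , f≡ , h≡) (refl , f′≡ , h′≡) =
      ℕ.≰⇒> λ i′+s≤i → ℕ.<⇒≢ (natVal< i′+s≤i) (sym same-sum)
      where
      U V : ℕ
      U = Q.spread f₀
      V = R.spread h₀
      add-back : ∀ z m → z ≡ (z ℤ.- m) ℤ.+ m
      add-back = solve-∀
      swap : ∀ y t m → y ℤ.+ t ℤ.+ m ≡ (y ℤ.+ m) ℤ.+ t
      swap = solve-∀
      value : ∀ i j k m → z ℤ.- + m ≡ val (+ i) (+ j) (+ k) t → z ≡ + (natVal i j k + m) ℤ.+ t ℤ.* (+ p ℤ.* (+ q ℤ.* + r))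
      value i j k m eq = trans (add-back z (+ m)) (trans (cong (ℤ._+ + m) (trans eq (val-natVal i j k t)))
        (trans (swap (+ natVal i j k) (t ℤ.* (+ p ℤ.* (+ q ℤ.* + r))) (+ m))
          (cong (ℤ._+ t ℤ.* (+ p ℤ.* (+ q ℤ.* + r))) (sym (ℤ.pos-+ (natVal i j k) m)))))
      same-sum : natVal i j k + m ≡ natVal i′ j′ k′ + m′
      same-sum = ℤ.+-injective (+-cancelʳ (t ℤ.* (+ p ℤ.* (+ q ℤ.* + r))) _ _ (trans (sym (value i j k m eq)) (value i′ j′ k′ m′ eq′)))
      regroup : ∀ i j k p q r → i * (q * r) + j * (p * r) + k * (p * q) + (r + q) ≡ i * (q * r) + (p * j + 1) * r + (p * k + 1) * q
      regroup = ℕ-Solver.solve-∀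
      regroup′ : ∀ i j k p q r U V → i * (q * r) + (p * j + q * U) * r + (p * k + r * V) * q ≡
        (i + (U + V)) * (q * r) + j * (p * r) + k * (p * q)
      regroup′ = ℕ-Solver.solve-∀
      natVal< : i′ + (U + V) ≤ i → natVal i′ j′ k′ + m′ < natVal i j k + m
      natVal< i′+s≤i = begin-strict
        natVal i′ j′ k′ + m′                                               <⟨ ℕ.+-monoʳ-< (natVal i′ j′ k′) (ℕ.<-≤-trans (ℕ.<-trans m′<p p<r) (ℕ.m≤m+n r q)) ⟩
        natVal i′ j′ k′ + (r + q)                                          ≡⟨ regroup i′ j′ k′ p q r ⟩
        i′ * (q * r) + (p * j′ + 1) * r + (p * k′ + 1) * q                 ≤⟨ ℕ.+-mono-≤
                                                                                (ℕ.+-monoʳ-≤ (i′ * (q * r)) (ℕ.*-monoˡ-≤ r (Q.spread-bound j′<q j<q f′≡ f≡)))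
                                                                                (ℕ.*-monoˡ-≤ q (R.spread-bound k′<r k<r h′≡ h≡)) ⟩
        i′ * (q * r) + (p * j + q * U) * r + (p * k + r * V) * q           ≡⟨ regroup′ i′ j k p q r U V ⟩
        (i′ + (U + V)) * (q * r) + j * (p * r) + k * (p * q)               ≤⟨ ℕ.+-monoˡ-≤ _ (ℕ.+-monoˡ-≤ _ (ℕ.*-monoˡ-≤ (q * r) i′+s≤i)) ⟩
        natVal i j k                                                       ≤⟨ ℕ.m≤m+n _ m ⟩
        natVal i j k + m                                                   ∎
        where open ℕ.≤-Reasoning

    private
      module _ (m : ℕ) where
        module Digit = Rep (rep (z ℤ.- + m))

    CellAt : ℤ → Bool → Bool → ℕ → Set
    CellAt t₀ f₀ h₀ m = Cell t₀ f₀ h₀ (Digit.t m) (wraps q w (Digit.j m)) (wraps r x (Digit.k m))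

    cellAt? : ∀ t₀ f₀ h₀ → Decidable (CellAt t₀ f₀ h₀)
    cellAt? t₀ f₀ h₀ m = cell? t₀ f₀ h₀ (Digit.t m) (wraps q w (Digit.j m)) (wraps r x (Digit.k m))

    InRangeAt : ℕ → ℕ → ℕ → Set
    InRangeAt lo hi m = InRange lo hi (Digit.i m)

    inRangeAt? : ∀ lo hi → Decidable (InRangeAt lo hi)
    inRangeAt? lo hi m = inRange? lo hi (Digit.i m)

    count-digits : ∀ {P : ℕ → Set} (P? : Decidable P) g →
      (∀ {m m′} → m < p → m′ < p → P m → P m′ → Digit.i m < Digit.i m′ + g) → count P? p ≤ g
    count-digits P? g window = count-window P? Digit.i p g
      (λ {m} {m′} m<p m′<p _ _ → injective-i m<p m′<p (Digit.isVal m) (Digit.isVal m′))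
      window p (λ {m} _ _ → Digit.i<p m)

    module _ {lo hi : ℕ} {P : ℕ → Set} (P? : Decidable P) (P⊆ : ∀ {m} → P m → InRangeAt lo hi m) where

      count-range : count P? p ≤ hi ∸ lo
      count-range = count-digits P? (hi ∸ lo) λ {m} {m′} _ _ Pm Pm′ → begin-strict
        Digit.i m                <⟨ proj₂ (P⊆ Pm) ⟩
        hi                       ≤⟨ ℕ.m≤n+m∸n hi lo ⟩
        lo + (hi ∸ lo)           ≤⟨ ℕ.+-monoˡ-≤ (hi ∸ lo) (proj₁ (P⊆ Pm′)) ⟩
        Digit.i m′ + (hi ∸ lo)   ∎
        where open ℕ.≤-Reasoning

    module _ (lo hi lo′ hi′ : ℕ) (t₀ : ℤ) (f₀ h₀ : Bool) where

      P? : Decidable (InRangeAt lo hi)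
      P? = inRangeAt? lo hi

      Q? : Decidable (λ m → InRangeAt lo′ hi′ m × CellAt t₀ f₀ h₀ m)
      Q? m = inRangeAt? lo′ hi′ m ×-dec cellAt? t₀ f₀ h₀ m

      sum-bound : ∀ (y : ℕ → ℤ) → (∀ {m} → m < p → y m ℤ.≤ + (indicator (P? m) + indicator (Q? m))) →
        (∑ y p ℤ.≤ + (hi ∸ lo + (hi′ ∸ lo′))) × (∑ y p ℤ.≤ + (hi ∸ lo + (Q.spread f₀ + R.spread h₀)))
      sum-bound y y≤ = bound (count-range Q? proj₁) , bound cells
        where
        bound : ∀ {g} → count Q? p ≤ g → ∑ y p ℤ.≤ + (hi ∸ lo + g)
        bound g≤ = ℤ.≤-trans (∑-≤-count P? Q? y p y≤) (ℤ.+≤+ (ℕ.+-mono-≤ (count-range P? λ Pm → Pm) g≤))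
        cells : count Q? p ≤ Q.spread f₀ + R.spread h₀
        cells = count-digits Q? _ λ {m} {m′} m<p m′<p (_ , cell) (_ , cell′) →
          cell-window t₀ f₀ h₀ m<p m′<p (Digit.j<q m) (Digit.j<q m′) (Digit.k<r m) (Digit.k<r m′)
            (Digit.isVal m) (Digit.isVal m′) cell cell′

    module _ (z<N : z ℤ.< + (p * q * r)) where

      summand : ℕ → ℤ
      summand m = Δ q (Δ r c) (z ℤ.- + m)

      at-zone : ∀ e₁ e₂ e₃ {upper lower} → (∀ t f h → Bounded e₁ e₂ e₃ upper lower t f h) → ∀ m i₁ i₂ i₃ →
        (i₁ < p × + i₁ ≡ + Digit.i m ℤ.+ (ℤ.- + u ℤ.+ e₁ ℤ.* + p)) →
        (i₂ < p × + i₂ ≡ + Digit.i m ℤ.+ (ℤ.- + v ℤ.+ e₂ ℤ.* + p)) →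
        (i₃ < p × + i₃ ≡ + i₂ ℤ.+ (ℤ.- + u ℤ.+ e₃ ℤ.* + p)) →
        let t = Digit.t m ; f = wraps q w (Digit.j m) ; h = wraps r x (Digit.k m) in
        summand m ℤ.≤ + upper t f h × ℤ.- summand m ℤ.≤ + lower t f h
      at-zone e₁ e₂ e₃ {upper} {lower} bounded m i₁ i₂ i₃ (i₁<p , i₁≡) (i₂<p , i₂≡) (i₃<p , i₃≡) =
        subst (λ y → y ℤ.≤ + upper t f h × ℤ.- y ℤ.≤ + lower t f h) (sym (proj₁ value)) (bounded t f h (proj₂ value))
        where
        t : ℤ
        t = Digit.t m
        f h : Bool
        f = wraps q w (Digit.j m)
        h = wraps r x (Digit.k m)
        value : summand m ≡ corner e₁ e₂ e₃ t f h × Admissible e₁ e₂ e₃ t f h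
        value = Δ-corner i₁ i₂ i₃ e₁ e₂ e₃ (Digit.i<p m) (Digit.j<q m) (Digit.k<r m) i₁<p i₂<p i₃<p i₁≡ i₂≡ i₃≡
          (Digit.isVal m) (ℤ.≤-<-trans (ℤ.i-j≤i z (+ m)) z<N)

      private
        lowered : ∀ {i u} → i < p → u ≤ i → i ∸ u < p × + (i ∸ u) ≡ + i ℤ.+ (ℤ.- + u ℤ.+ 0ℤ ℤ.* + p)
        lowered {i} {u} i<p u≤i = ℕ.≤-<-trans (ℕ.m∸n≤m i u) i<p , lower-digit p u≤i

        ∸-< : ∀ {i} → v ≤ i → i < u + v → i ∸ v < u
        ∸-< v≤i i<u+v = ℕ.+-cancelʳ-< v _ _ (subst (_< u + v) (sym (ℕ.m∸n+n≡m v≤i)) i<u+v)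

        borrowed : ∀ {i u} → i < u → u < p → i + p ∸ u < p × + (i + p ∸ u) ≡ + i ℤ.+ (ℤ.- + u ℤ.+ 1ℤ ℤ.* + p)
        borrowed {i} {u} i<u u<p = borrow-digit< i<u (ℕ.<⇒≤ u<p) , borrow-digit i (ℕ.<⇒≤ u<p)

      module _ (u≤v : u ≤ v) (u+v≤p : u + v ≤ p) where

        summand-small : ∀ m →
          summand m ℤ.≤ + (indicator (P? 0 u (u + v) p -[1+ 1 ] true true m) + indicator (Q? 0 u (u + v) p -[1+ 1 ] true true m)) ×
          ℤ.- summand m ℤ.≤ + (indicator (P? v (u + v) u v -1ℤ true false m) + indicator (Q? v (u + v) u v -1ℤ true false m))
        summand-small m = cases (Digit.i m ℕ.<? u) (Digit.i m ℕ.<? v) (Digit.i m ℕ.<? u + v)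
          where
          i : ℕ
          i = Digit.i m
          i<p : i < p
          i<p = Digit.i<p m
          above : ∀ {y} → i < v → y ≤ p ∸ v → y ≤ i + p ∸ v
          above i<v y≤ = ℕ.≤-trans y≤ (ℕ.∸-monoˡ-≤ v (ℕ.m≤n+m p i))
          u≤p∸v : u ≤ p ∸ v
          u≤p∸v = ℕ.m+n≤o⇒m≤o∸n u u+v≤p
          up₁? = inRangeAt? 0 u m
          up₂? = inRangeAt? (u + v) p m
          up₃? = cellAt? -[1+ 1 ] true true m
          lo₁? = inRangeAt? v (u + v) m
          lo₂? = inRangeAt? u v m
          lo₃? = cellAt? -1ℤ true false m
          cases : Dec (i < u) → Dec (i < v) → Dec (i < u + v) →
            summand m ℤ.≤ + (indicator up₁? + indicator (up₂? ×-dec up₃?)) ×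
            ℤ.- summand m ℤ.≤ + (indicator lo₁? + indicator (lo₂? ×-dec lo₃?))
          cases (yes i<u) _ _ =
            let i<v = ℕ.<-≤-trans i<u u≤v
                b = borrowed i<v v<p
                upper , lower = at-zone 1ℤ 1ℤ 0ℤ zone₁₁₀ m _ _ _ (borrowed i<u u<p) b (lowered (proj₁ b) (above i<v u≤p∸v))
            in by-first up₁? up₂? up₃? (z≤n , i<u) upper , by-none lo₁? lo₂? lo₃? lower
          cases (no i≮u) (yes i<v) _ =
            let b = borrowed i<v v<p
                upper , lower = at-zone 0ℤ 1ℤ 0ℤ zone₀₁₀ m _ _ _ (lowered i<p (ℕ.≮⇒≥ i≮u)) b (lowered (proj₁ b) (above i<v u≤p∸v))
            in by-none up₁? up₂? up₃? upper , by-second lo₁? lo₂? lo₃? (ℕ.≮⇒≥ i≮u , i<v) lower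
          cases (no i≮u) (no i≮v) (yes i<u+v) =
            let upper , lower = at-zone 0ℤ 0ℤ 1ℤ zone₀₀₁ m _ _ _ (lowered i<p (ℕ.≮⇒≥ i≮u)) (lowered i<p (ℕ.≮⇒≥ i≮v))
                  (borrowed (∸-< (ℕ.≮⇒≥ i≮v) i<u+v) u<p)
            in by-none up₁? up₂? up₃? upper , by-first lo₁? lo₂? lo₃? (ℕ.≮⇒≥ i≮v , i<u+v) lower
          cases (no i≮u) (no i≮v) (no i≮u+v) =
            let b = lowered i<p (ℕ.≮⇒≥ i≮v)
                upper , lower = at-zone 0ℤ 0ℤ 0ℤ zone₀₀₀ m _ _ _ (lowered i<p (ℕ.≮⇒≥ i≮u)) b
                  (lowered (proj₁ b) (ℕ.m+n≤o⇒m≤o∸n u (ℕ.≮⇒≥ i≮u+v)))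
            in by-second up₁? up₂? up₃? (ℕ.≮⇒≥ i≮u+v , i<p) upper , by-none lo₁? lo₂? lo₃? lower

        coefficient-small :
          ((a z ℤ.≤ + (u + (p ∸ (u + v)))) × (a z ℤ.≤ + (u + (u + v)))) ×
          ((ℤ.- a z ℤ.≤ + (u + v ∸ v + (v ∸ u))) × (ℤ.- a z ℤ.≤ + (u + v ∸ v + (u + (p ∸ v)))))
        coefficient-small =
          sum-bound 0 u (u + v) p -[1+ 1 ] true true summand (λ {m} _ → proj₁ (summand-small m)) ,
          subst (λ y → (y ℤ.≤ _) × (y ℤ.≤ _)) (sym (∑-neg summand p))
            (sum-bound v (u + v) u v -1ℤ true false (λ m → ℤ.- summand m) (λ {m} _ → proj₂ (summand-small m)))

      module _ (u≤v : u ≤ v) (p≤u+v : p ≤ u + v) where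

        summand-large : ∀ m →
          summand m ℤ.≤ + (indicator (P? (u + v ∸ p) u 0 (u + v ∸ p) 0ℤ false false m) +
            indicator (Q? (u + v ∸ p) u 0 (u + v ∸ p) 0ℤ false false m)) ×
          ℤ.- summand m ℤ.≤ + (indicator (P? v p u v -1ℤ true false m) + indicator (Q? v p u v -1ℤ true false m))
        summand-large m = cases (Digit.i m ℕ.<? u + v ∸ p) (Digit.i m ℕ.<? u) (Digit.i m ℕ.<? v)
          where
          i : ℕ
          i = Digit.i m
          i<p : i < p
          i<p = Digit.i<p m
          u+v∸p≤u : u + v ∸ p ≤ u
          u+v∸p≤u = ℕ.m≤n+o⇒m∸n≤o (u + v) p (subst (u + v ≤_) (ℕ.+-comm u p) (ℕ.+-monoʳ-≤ u (ℕ.<⇒≤ v<p)))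
          p≤i+p : p ≤ i + p
          p≤i+p = ℕ.m≤n+m p i
          up₁? = inRangeAt? (u + v ∸ p) u m
          up₂? = inRangeAt? 0 (u + v ∸ p) m
          up₃? = cellAt? 0ℤ false false m
          lo₁? = inRangeAt? v p m
          lo₂? = inRangeAt? u v m
          lo₃? = cellAt? -1ℤ true false m
          borrows : i < u + v ∸ p → i + p ∸ v < u
          borrows i< = ℕ.+-cancelʳ-< v _ _ (subst (_< u + v) (sym (ℕ.m∸n+n≡m (ℕ.≤-trans (ℕ.<⇒≤ v<p) p≤i+p)))
            (subst (i + p <_) (ℕ.m∸n+n≡m p≤u+v) (ℕ.+-monoˡ-< p i<)))
          borrows-not : u + v ∸ p ≤ i → u ≤ i + p ∸ v
          borrows-not ≤i = ℕ.m+n≤o⇒m≤o∸n u (subst (_≤ i + p) (ℕ.m∸n+n≡m p≤u+v) (ℕ.+-monoˡ-≤ p ≤i))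
          cases : Dec (i < u + v ∸ p) → Dec (i < u) → Dec (i < v) →
            summand m ℤ.≤ + (indicator up₁? + indicator (up₂? ×-dec up₃?)) ×
            ℤ.- summand m ℤ.≤ + (indicator lo₁? + indicator (lo₂? ×-dec lo₃?))
          cases (yes i<b) _ _ =
            let i<u = ℕ.<-≤-trans i<b u+v∸p≤u
                upper , lower = at-zone 1ℤ 1ℤ 1ℤ zone₁₁₁ m _ _ _ (borrowed i<u u<p)
                  (borrowed (ℕ.<-≤-trans i<u u≤v) v<p) (borrowed (borrows i<b) u<p)
            in by-second up₁? up₂? up₃? (z≤n , i<b) upper , by-none lo₁? lo₂? lo₃? lower
          cases (no i≮b) (yes i<u) _ =
            let b = borrowed (ℕ.<-≤-trans i<u u≤v) v<p
                upper , lower = at-zone 1ℤ 1ℤ 0ℤ zone₁₁₀ m _ _ _ (borrowed i<u u<p) b (lowered (proj₁ b) (borrows-not (ℕ.≮⇒≥ i≮b)))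
            in by-first up₁? up₂? up₃? (ℕ.≮⇒≥ i≮b , i<u) upper , by-none lo₁? lo₂? lo₃? lower
          cases (no i≮b) (no i≮u) (yes i<v) =
            let b = borrowed i<v v<p
                upper , lower = at-zone 0ℤ 1ℤ 0ℤ zone₀₁₀ m _ _ _ (lowered i<p (ℕ.≮⇒≥ i≮u)) b (lowered (proj₁ b) (borrows-not (ℕ.≮⇒≥ i≮b)))
            in by-none up₁? up₂? up₃? upper , by-second lo₁? lo₂? lo₃? (ℕ.≮⇒≥ i≮u , i<v) lower
          cases (no i≮b) (no i≮u) (no i≮v) =
            let upper , lower = at-zone 0ℤ 0ℤ 1ℤ zone₀₀₁ m _ _ _ (lowered i<p (ℕ.≮⇒≥ i≮u)) (lowered i<p (ℕ.≮⇒≥ i≮v))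
                  (borrowed (∸-< (ℕ.≮⇒≥ i≮v) (ℕ.<-≤-trans i<p p≤u+v)) u<p)
            in by-none up₁? up₂? up₃? upper , by-first lo₁? lo₂? lo₃? (ℕ.≮⇒≥ i≮v , i<p) lower

        coefficient-large :
          ((a z ℤ.≤ + (u ∸ (u + v ∸ p) + (u + v ∸ p))) × (a z ℤ.≤ + (u ∸ (u + v ∸ p) + (p ∸ u + (p ∸ v))))) ×
          ((ℤ.- a z ℤ.≤ + (p ∸ v + (v ∸ u))) × (ℤ.- a z ℤ.≤ + (p ∸ v + (u + (p ∸ v)))))
        coefficient-large =
          sum-bound (u + v ∸ p) u 0 (u + v ∸ p) 0ℤ false false summand (λ {m} _ → proj₁ (summand-large m)) ,
          subst (λ y → (y ℤ.≤ _) × (y ℤ.≤ _)) (sym (∑-neg summand p))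
            (sum-bound v p u v -1ℤ true false (λ m → ℤ.- summand m) (λ {m} _ → proj₂ (summand-large m)))

1<prime : ∀ {p} → Prime p → 1 < p
1<prime {p} pr = nonTrivial⇒n>1 p {{prime⇒nonTrivial pr}}

∤⇒coprime : ∀ {p k} → Prime p → ¬ p ∣ k → Coprime k p
∤⇒coprime pr p∤k (d∣k , d∣p) with prime⇒irreducible pr d∣p
... | inj₁ d≡1  = d≡1
... | inj₂ refl = contradiction d∣k p∤k

primes-coprime : ∀ {p q} → Prime p → Prime q → p ≢ q → Coprime p q
primes-coprime prp prq p≢q = ∤⇒coprime prq λ q∣p → q∤p (prime⇒irreducible prp q∣p)
  where
  q∤p : _ → _
  q∤p (inj₁ q≡1) = ℕ.<⇒≢ (1<prime prq) (sym q≡1)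
  q∤p (inj₂ q≡p) = p≢q (sym q≡p)

coprime-*ˡ : ∀ {a b m} → Coprime a m → Coprime b m → Coprime (a * b) m
coprime-*ˡ a⊥m b⊥m {d} (d∣ab , d∣m) =
  b⊥m (coprime-divisor (λ (e∣d , e∣a) → a⊥m (e∣a , ∣-trans e∣d d∣m)) d∣ab , d∣m)

coprime-∣ : ∀ {a b k} → Coprime a b → a ∣ k → b ∣ k → a * b ∣ k
coprime-∣ {a} {b} a⊥b (divides m refl) b∣ma with coprime-divisor (Coprimality.sym a⊥b) (subst (b ∣_) (ℕ.*-comm m a) b∣ma)
... | divides l refl = divides l (trans (ℕ.*-assoc l b a) (cong (l *_) (ℕ.*-comm b a)))

≡1[mod]⇒ : ∀ {p a} → 0 < a → a ≡ 1 [mod p ] → ∃[ w ] a ≡ 1 + p * w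
≡1[mod]⇒ {p} {suc a} _ (divides w a≡wp) = w , cong suc (trans a≡wp (ℕ.*-comm w p))

indicator-⇔ : ∀ {A B : Set} (a? : Dec A) (b? : Dec B) → (A → B) → (B → A) → indicator a? ≡ indicator b?
indicator-⇔ a? b? f g = ℕ.≤-antisym (indicator-mono a? b? f) (indicator-mono b? a? g)

inclusion-exclusion : ∀ {A B C : Set} (a? : Dec A) (b? : Dec B) (c? : Dec C) →
  indicator a? + (indicator b? + (indicator c? + (indicator ((a? ×-dec b?) ×-dec c?) + indicator (¬? a? ×-dec ¬? b? ×-dec ¬? c?))))
  ≡ indicator (b? ×-dec c?) + (indicator (a? ×-dec c?) + (indicator (a? ×-dec b?) + 1))
inclusion-exclusion (yes _) (yes _) (yes _) = refl
inclusion-exclusion (yes _) (yes _) (no _)  = refl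
inclusion-exclusion (yes _) (no _)  (yes _) = refl
inclusion-exclusion (yes _) (no _)  (no _)  = refl
inclusion-exclusion (no _)  (yes _) (yes _) = refl
inclusion-exclusion (no _)  (yes _) (no _)  = refl
inclusion-exclusion (no _)  (no _)  (yes _) = refl
inclusion-exclusion (no _)  (no _)  (no _)  = refl

IsUnit : ℕ → ℕ → Set
IsUnit n k = 0 < k × gcd k n ≡ 1

isUnit? : ∀ n k → Dec (IsUnit n k)
isUnit? n k = (0 ℕ.<? k) ×-dec (gcd k n ℕ.≟ 1)

length-units< : ∀ n .{{_ : NonZero n}} → length (filter (isUnit? n) (upTo n)) < n
length-units< n@(suc _) = subst (length (filter (isUnit? n) (upTo n)) <_) (List.length-upTo n)
  (List.filter-notAll (isUnit? n) (upTo n) (here λ (0<0 , _) → ℕ.n≮n 0 0<0))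

module Exponents {p q r : ℕ} (prp : Prime p) (prq : Prime q) (prr : Prime r)
  (p⊥q : Coprime p q) (p⊥r : Coprime p r) (q⊥r : Coprime q r) where

  pq⊥r : Coprime (p * q) r
  pq⊥r = coprime-*ˡ p⊥r q⊥r

  indicator-* : ∀ {a b} k → Coprime a b → indicator ((a * b) ∣? k) ≡ indicator ((a ∣? k) ×-dec (b ∣? k))
  indicator-* {a} {b} k a⊥b = indicator-⇔ ((a * b) ∣? k) ((a ∣? k) ×-dec (b ∣? k))
    (λ ab∣k → ∣-trans (m∣m*n b) ab∣k , ∣-trans (n∣m*n a) ab∣k) (λ (a∣k , b∣k) → coprime-∣ a⊥b a∣k b∣k)

  unit⇔ : ∀ k → indicator (isUnit? (p * q * r) k) ≡ indicator (¬? (p ∣? k) ×-dec ¬? (q ∣? k) ×-dec ¬? (r ∣? k))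
  unit⇔ k = indicator-⇔ (isUnit? (p * q * r) k) (¬? (p ∣? k) ×-dec ¬? (q ∣? k) ×-dec ¬? (r ∣? k))
    (λ (_ , gcd≡1) → avoid gcd≡1 prp (∣-trans (m∣m*n q) (m∣m*n r)) ,
      avoid gcd≡1 prq (∣-trans (n∣m*n p) (m∣m*n r)) , avoid gcd≡1 prr (n∣m*n (p * q)))
    (λ (p∤k , q∤k , r∤k) → positive k p∤k , coprime⇒gcd≡1 (Coprimality.sym (coprime-*ˡ (coprime-*ˡ
      (Coprimality.sym (∤⇒coprime prp p∤k)) (Coprimality.sym (∤⇒coprime prq q∤k))) (Coprimality.sym (∤⇒coprime prr r∤k)))))
    where
    avoid : ∀ {s} → gcd k (p * q * r) ≡ 1 → Prime s → s ∣ p * q * r → ¬ s ∣ k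
    avoid gcd≡1 prs s∣N s∣k = ℕ.<⇒≢ (1<prime prs) (sym (gcd≡1⇒coprime gcd≡1 (s∣k , s∣N)))
    positive : ∀ k → ¬ p ∣ k → 0 < k
    positive zero    p∤0 = contradiction (divides 0 refl) p∤0
    positive (suc _) _   = s≤s z≤n

  exponents : ∀ k →
    indicator (p ∣? k) + (indicator (q ∣? k) + (indicator (r ∣? k) + (indicator ((p * q * r) ∣? k) + indicator (isUnit? (p * q * r) k))))
    ≡ indicator ((q * r) ∣? k) + (indicator ((p * r) ∣? k) + (indicator ((p * q) ∣? k) + indicator (1 ∣? k)))
  exponents k = trans
    (cong (λ e → indicator (p ∣? k) + (indicator (q ∣? k) + (indicator (r ∣? k) + e))) (cong₂ _+_
      (trans (indicator-* k pq⊥r) (indicator-⇔ (((p * q) ∣? k) ×-dec (r ∣? k)) (((p ∣? k) ×-dec (q ∣? k)) ×-dec (r ∣? k))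
        (λ (pq∣k , r∣k) → (∣-trans (m∣m*n q) pq∣k , ∣-trans (n∣m*n p) pq∣k) , r∣k)
        (λ ((p∣k , q∣k) , r∣k) → coprime-∣ p⊥q p∣k q∣k , r∣k)))
      (unit⇔ k)))
    (trans (inclusion-exclusion (p ∣? k) (q ∣? k) (r ∣? k))
      (sym (cong₂ _+_ (indicator-* k q⊥r) (cong₂ _+_ (indicator-* k p⊥r) (cong₂ _+_ (indicator-* k p⊥q)
        (indicator-yes (1 ∣? k) (divides k (sym (ℕ.*-identityʳ k)))))))))

module _ {p q r u v w x β : ℕ} (β<p : β < p) (qu≡1+pw : q * u ≡ 1 + p * w) (rv≡1+px : r * v ≡ 1 + p * x) where

  private
    ∣-inverse : ∀ q u {w} → q * u ≡ 1 + p * w → + p Signed.∣ + q ℤ.* + u ℤ.- 1ℤ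
    ∣-inverse q u {w} eq = Signed.divides (+ w) (trans
      (cong (ℤ._- 1ℤ) (trans (sym (ℤ.pos-* q u)) (trans (cong +_ eq) (cong (ℤ._+_ 1ℤ) (ℤ.pos-* p w)))))
      (identity (+ p) (+ w)))
      where
      identity : ∀ p w → 1ℤ ℤ.+ p ℤ.* w ℤ.- 1ℤ ≡ w ℤ.* p
      identity = solve-∀

    ∣-product : ∀ α → α * β * q * r ≡ 1 [mod p ] → + p Signed.∣ + α ℤ.* + β ℤ.* + q ℤ.* + r ℤ.- 1ℤ
    ∣-product α cong1 = subst (λ y → + p Signed.∣ y ℤ.- 1ℤ)
      (trans (ℤ.pos-* (α * β * q) r) (cong (ℤ._* + r) (trans (ℤ.pos-* (α * β) q) (cong (ℤ._* + q) (ℤ.pos-* α β)))))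
      (Signed.∣ᵤ⇒∣ {+ p} {+ (α * β * q * r) ℤ.- 1ℤ} cong1)

    ∣-inverses : + p Signed.∣ + β ℤ.* ((+ q ℤ.* + u ℤ.- 1ℤ) ℤ.* (+ r ℤ.* + v) ℤ.+ (+ r ℤ.* + v ℤ.- 1ℤ))
    ∣-inverses = Signed.∣n⇒∣m*n (+ β) (Signed.∣m∣n⇒∣m+n
      (Signed.∣m⇒∣m*n (+ r ℤ.* + v) (∣-inverse q u qu≡1+pw)) (∣-inverse r v rv≡1+px))

  β≡v : v < p → u * β * q * r ≡ 1 [mod p ] → β ≡ v
  β≡v v<p uβqr≡1 = ∣-difference⇒≡ β<p v<p (Signed.∣⇒∣ᵤ (subst (+ p Signed.∣_) (identity (+ u) (+ v) (+ q) (+ r) (+ β))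
    (Signed.∣m∣n⇒∣m-n (Signed.∣n⇒∣m*n (+ v) (∣-product u uβqr≡1)) ∣-inverses)))
    where
    identity : ∀ u v q r β → v ℤ.* (u ℤ.* β ℤ.* q ℤ.* r ℤ.- 1ℤ) ℤ.- β ℤ.* ((q ℤ.* u ℤ.- 1ℤ) ℤ.* (r ℤ.* v) ℤ.+ (r ℤ.* v ℤ.- 1ℤ)) ≡ β ℤ.- v
    identity = solve-∀

  β≡p∸u : 0 < u → u < p → v < p → (p ∸ v) * β * q * r ≡ 1 [mod p ] → β ≡ p ∸ u
  β≡p∸u 0<u u<p v<p αβqr≡1 = ∣-difference⇒≡ β<p (ℕ.∸-monoʳ-< 0<u (ℕ.<⇒≤ u<p)) (Signed.∣⇒∣ᵤ (subst (+ p Signed.∣_)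
    (trans (identity (+ p) (+ u) (+ v) (+ q) (+ r) (+ β)) (cong (ℤ._-_ (+ β)) (sym (pos-∸ (ℕ.<⇒≤ u<p)))))
    (Signed.∣m∣n⇒∣m-n (Signed.∣m⇒∣m*n (+ u ℤ.* + β ℤ.* + q ℤ.* + r ℤ.- 1ℤ) Signed.∣-refl)
      (Signed.∣m∣n⇒∣m+n (Signed.∣n⇒∣m*n (+ u) (subst (λ y → + p Signed.∣ y ℤ.* + β ℤ.* + q ℤ.* + r ℤ.- 1ℤ)
        (pos-∸ (ℕ.<⇒≤ v<p)) (∣-product (p ∸ v) αβqr≡1))) ∣-inverses))))
    where
    identity : ∀ p u v q r β →
      p ℤ.* (u ℤ.* β ℤ.* q ℤ.* r ℤ.- 1ℤ) ℤ.-
      (u ℤ.* ((p ℤ.- v) ℤ.* β ℤ.* q ℤ.* r ℤ.- 1ℤ) ℤ.+ β ℤ.* ((q ℤ.* u ℤ.- 1ℤ) ℤ.* (r ℤ.* v) ℤ.+ (r ℤ.* v ℤ.- 1ℤ))) ≡ β ℤ.- (p ℤ.- u)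
    identity = solve-∀

count-multiples : ∀ d .{{_ : NonZero d}} m → count (d ∣?_) (d * m) ≡ m
count-multiples d       zero    = cong (count (d ∣?_)) (ℕ.*-zeroʳ d)
count-multiples d@(suc d′) (suc m) = trans (cong (count (d ∣?_)) (ℕ.*-suc d m)) (block d′ ℕ.≤-refl)
  where
  block : ∀ s → s < d → count (d ∣?_) (suc s + d * m) ≡ suc m
  block zero    _    = trans (cong₂ _+_ (count-multiples d m) (indicator-yes (d ∣? (d * m)) (m∣m*n m))) (ℕ.+-comm m 1)
  block (suc s) s<d  = trans (cong₂ _+_ (block s (ℕ.<⇒≤ s<d)) (indicator-no (d ∣? (suc s + d * m))
    λ d∣ → >⇒∤ s<d (∣m+n∣m⇒∣n (subst (d ∣_) (ℕ.+-comm (suc s) (d * m)) d∣) (m∣m*n m)))) (ℕ.+-identityʳ _)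

module Sequences {c ℓ₁ ℓ₂} (K : HeytingField c ℓ₁ ℓ₂) where

  open HeytingField K using (Carrier; _≈_; 0#; 1#; tight; #⇒invertible; heytingCommutativeRing)
    renaming (_+_ to _⊕_; _*_ to _⊗_; -_ to ⊖_)
  open CommutativeRing (HeytingCommutativeRing.commutativeRing heytingCommutativeRing)
    using (reflexive; setoid; semiring; ring; commutativeSemiring; +-monoid;
      +-cong; +-congˡ; +-congʳ; *-congˡ; *-congʳ;
      +-assoc; +-comm; *-assoc; *-comm; +-identityˡ; +-identityʳ;
      *-identityˡ; *-identityʳ; zeroˡ; zeroʳ; -‿inverseˡ; -‿inverseʳ; -‿cong)
    renaming (refl to ≈-refl; sym to ≈-sym; trans to ≈-trans)
  open Mult +-monoid using (×-homo-+) renaming (_×_ to infixr 8 _⊠_)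
  open Exp semiring using (_^_; ^-homo-*; ^-assocʳ; ^-congˡ)
  open RingProperties ring using (-0#≈0#; -‿+-comm; -‿involutive; x∙y⁻¹≈ε⇒x≈y; -1*x≈-x; -‿injective)
    renaming (+-cancelˡ to +ᴷ-cancelˡ)
  open SemiringSolver commutativeSemiring using (solve; _:=_; _:+_; _:*_; con)
  open import Relation.Binary.Reasoning.Setoid setoid
  open Cyclotomic K

  integral : ∀ {x y} → ¬ (x ≈ 0#) → x ⊗ y ≈ 0# → y ≈ 0#
  integral {x} {y} x≉0 xy≈0 = proj₁ (tight y 0#) λ y#0 →
    let y⁻¹ , _ , inverse = #⇒invertible y#0 in x≉0 (begin
      x                        ≈⟨ *-identityʳ x ⟨
      x ⊗ 1#                   ≈⟨ *-congˡ inverse ⟨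
      x ⊗ ((y ⊕ ⊖ 0#) ⊗ y⁻¹)   ≈⟨ *-congˡ (*-congʳ (≈-trans (+-congˡ -0#≈0#) (+-identityʳ y))) ⟩
      x ⊗ (y ⊗ y⁻¹)            ≈⟨ *-assoc x y y⁻¹ ⟨
      x ⊗ y ⊗ y⁻¹              ≈⟨ *-congʳ xy≈0 ⟩
      0# ⊗ y⁻¹                 ≈⟨ zeroˡ y⁻¹ ⟩
      0#                       ∎)

  fromℤ-⊖ : ∀ m n → fromℤ (m ℤ.⊖ n) ≈ m ⊠ 1# ⊕ ⊖ (n ⊠ 1#)
  fromℤ-⊖ m       zero    = ≈-sym (≈-trans (+-congˡ -0#≈0#) (+-identityʳ _))
  fromℤ-⊖ zero    (suc n) = ≈-sym (+-identityˡ _)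
  fromℤ-⊖ (suc m) (suc n) = begin
    fromℤ (suc m ℤ.⊖ suc n)                  ≡⟨ cong fromℤ (ℤ.[1+m]⊖[1+n]≡m⊖n m n) ⟩
    fromℤ (m ℤ.⊖ n)                          ≈⟨ fromℤ-⊖ m n ⟩
    m ⊠ 1# ⊕ ⊖ (n ⊠ 1#)                      ≈⟨ +-identityˡ _ ⟨
    0# ⊕ (m ⊠ 1# ⊕ ⊖ (n ⊠ 1#))               ≈⟨ +-congʳ (-‿inverseʳ 1#) ⟨
    1# ⊕ ⊖ 1# ⊕ (m ⊠ 1# ⊕ ⊖ (n ⊠ 1#))        ≈⟨ solve 4 (λ a b c d → a :+ b :+ (c :+ d) := a :+ c :+ (b :+ d)) ≈-refl 1# (⊖ 1#) (m ⊠ 1#) (⊖ (n ⊠ 1#)) ⟩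
    1# ⊕ m ⊠ 1# ⊕ (⊖ 1# ⊕ ⊖ (n ⊠ 1#))        ≈⟨ +-congˡ (-‿+-comm 1# (n ⊠ 1#)) ⟩
    1# ⊕ m ⊠ 1# ⊕ ⊖ (1# ⊕ n ⊠ 1#)            ∎

  fromℤ-+ : ∀ x y → fromℤ (x ℤ.+ y) ≈ fromℤ x ⊕ fromℤ y
  fromℤ-+ (+ m)    (+ n)    = ×-homo-+ 1# m n
  fromℤ-+ (+ m)    -[1+ n ] = fromℤ-⊖ m (suc n)
  fromℤ-+ -[1+ m ] (+ n)    = ≈-trans (fromℤ-⊖ n (suc m)) (+-comm _ _)
  fromℤ-+ -[1+ m ] -[1+ n ] = begin
    ⊖ (suc (suc (m + n)) ⊠ 1#)           ≡⟨ cong (λ k → ⊖ (suc k ⊠ 1#)) (ℕ.+-suc m n) ⟨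
    ⊖ ((suc m + suc n) ⊠ 1#)             ≈⟨ -‿cong (×-homo-+ 1# (suc m) (suc n)) ⟩
    ⊖ (suc m ⊠ 1# ⊕ suc n ⊠ 1#)          ≈⟨ -‿+-comm (suc m ⊠ 1#) (suc n ⊠ 1#) ⟨
    ⊖ (suc m ⊠ 1#) ⊕ ⊖ (suc n ⊠ 1#)      ∎

  fromℤ-neg : ∀ x → fromℤ (ℤ.- x) ≈ ⊖ fromℤ x
  fromℤ-neg (+ zero)  = ≈-sym -0#≈0#
  fromℤ-neg (+ suc _) = ≈-refl
  fromℤ-neg -[1+ _ ]  = ≈-sym (-‿involutive _)

  fromℤ-- : ∀ x y → fromℤ (x ℤ.- y) ≈ fromℤ x ⊕ ⊖ fromℤ y
  fromℤ-- x y = ≈-trans (fromℤ-+ x (ℤ.- y)) (+-congˡ (fromℤ-neg y))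

  fromℤ-injective₀ : CharacteristicZero → ∀ x → fromℤ x ≈ 0# → x ≡ 0ℤ
  fromℤ-injective₀ char (+ n)    n≈0  = cong +_ (char n n≈0)
  fromℤ-injective₀ char -[1+ n ] -n≈0 with char (suc n) (begin
    suc n ⊠ 1#         ≈⟨ -‿involutive _ ⟨
    ⊖ (⊖ (suc n ⊠ 1#)) ≈⟨ -‿cong -n≈0 ⟩
    ⊖ 0#               ≈⟨ -0#≈0# ⟩
    0#                 ∎)
  ... | ()

  fromℤ-1 : fromℤ 1ℤ ≈ 1#
  fromℤ-1 = +-identityʳ 1#

  Seq : Set c
  Seq = ℤ → Carrier

  infix 4 _≋_
  _≋_ : Seq → Seq → Set ℓ₁
  f ≋ g = ∀ z → f z ≈ g z

  -- X acts on sequences as the shift f ↦ f (· − 1), so this is multiplication by X − b.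
  times : Carrier → Seq → Seq
  times b f z = f (z ℤ.- 1ℤ) ⊕ ⊖ b ⊗ f z

  times-cong : ∀ b {f g} → f ≋ g → times b f ≋ times b g
  times-cong b f≋g z = +-cong (f≋g _) (*-congˡ (f≋g z))

  times-comm : ∀ b d f → times b (times d f) ≋ times d (times b f)
  times-comm b d f z = solve 5 (λ b d x y w →
      x :+ d :* y :+ b :* (y :+ d :* w) := x :+ b :* y :+ d :* (y :+ b :* w)) ≈-refl
    (⊖ b) (⊖ d) (f (z ℤ.- 1ℤ ℤ.- 1ℤ)) (f (z ℤ.- 1ℤ)) (f z)

  timesⁿ : ℕ → Carrier → Seq → Seq
  timesⁿ zero    b f = f
  timesⁿ (suc e) b f = times b (timesⁿ e b f)

  timesⁿ-cong : ∀ e b {f g} → f ≋ g → timesⁿ e b f ≋ timesⁿ e b g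
  timesⁿ-cong zero    b f≋g = f≋g
  timesⁿ-cong (suc e) b f≋g = times-cong b (timesⁿ-cong e b f≋g)

  timesⁿ-+ : ∀ e e′ b f → timesⁿ e b (timesⁿ e′ b f) ≋ timesⁿ (e + e′) b f
  timesⁿ-+ zero    e′ b f z = ≈-refl
  timesⁿ-+ (suc e) e′ b f   = times-cong b (timesⁿ-+ e e′ b f)

  times-timesⁿ : ∀ b e d f → times b (timesⁿ e d f) ≋ timesⁿ e d (times b f)
  times-timesⁿ b zero    d f z = ≈-refl
  times-timesⁿ b (suc e) d f z = ≈-trans (times-comm b d (timesⁿ e d f) z) (times-cong d (times-timesⁿ b e d f) z)

  -- The coefficients below the leading one, constant term first.
  Monic : ℕ → Set c
  Monic = Vec Carrier

  eval : ∀ {n} → Monic n → Carrier → Carrier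
  eval []      x = 1#
  eval (a ∷ g) x = a ⊕ x ⊗ eval g x

  act : ∀ {n} → Monic n → Seq → Seq
  act []      f z = f z
  act (a ∷ g) f z = a ⊗ f z ⊕ act g f (z ℤ.- 1ℤ)

  quotient : ∀ {n} → Monic (suc n) → Carrier → Monic n
  quotient (a ∷ [])    b = []
  quotient (a ∷ d ∷ g) b = eval (d ∷ g) b ∷ quotient (d ∷ g) b

  private
    cancel : ∀ {x y} b g → x ⊕ (⊖ b ⊕ b) ⊗ g ≈ y → x ≈ y
    cancel {x} b g eq = ≈-trans (≈-sym (≈-trans (+-congˡ (≈-trans (*-congʳ (-‿inverseˡ b)) (zeroˡ g))) (+-identityʳ x))) eq

  eval-quotient : ∀ {n} (g : Monic (suc n)) b x → eval g x ≈ (x ⊕ ⊖ b) ⊗ eval (quotient g b) x ⊕ eval g b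
  eval-quotient (a ∷ [])    b x = cancel b 1# (solve 4 (λ a b b′ x →
      a :+ x :* con 1 :+ (b′ :+ b) :* con 1 := (x :+ b′) :* con 1 :+ (a :+ b :* con 1)) ≈-refl a b (⊖ b) x)
  eval-quotient (a ∷ g@(_ ∷ _)) b x = cancel b (eval g b) (≈-trans
    (+-congʳ (+-congˡ (*-congˡ (eval-quotient g b x))))
    (solve 6 (λ a b b′ x h g →
      a :+ x :* ((x :+ b′) :* h :+ g) :+ (b′ :+ b) :* g := (x :+ b′) :* (g :+ x :* h) :+ (a :+ b :* g)) ≈-refl
      a b (⊖ b) x (eval (quotient g b) x) (eval g b)))

  act-quotient : ∀ {n} (g : Monic (suc n)) b f z → act g f z ≈ times b (act (quotient g b) f) z ⊕ eval g b ⊗ f z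
  act-quotient (a ∷ [])        b f z = cancel b (f z) (solve 5 (λ a b b′ x y →
      a :* x :+ y :+ (b′ :+ b) :* x := y :+ b′ :* x :+ (a :+ b :* con 1) :* x) ≈-refl a b (⊖ b) (f z) (f (z ℤ.- 1ℤ)))
  act-quotient (a ∷ g@(_ ∷ _)) b f z = cancel b (eval g b ⊗ f z) (≈-trans
    (+-congʳ (+-congˡ (act-quotient g b f (z ℤ.- 1ℤ))))
    (solve 8 (λ a b b′ x y h h′ g →
      a :* x :+ (h′ :+ b′ :* h :+ g :* y) :+ (b′ :+ b) :* (g :* x) :=
      g :* y :+ h′ :+ b′ :* (g :* x :+ h) :+ (a :+ b :* g) :* x) ≈-refl
      a b (⊖ b) (f z) (f (z ℤ.- 1ℤ)) (act (quotient g b) f (z ℤ.- 1ℤ)) (act (quotient g b) f (z ℤ.- 1ℤ ℤ.- 1ℤ)) (eval g b)))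

  binomial : ∀ n → Monic (suc n)
  binomial n = ⊖ 1# ∷ replicate n 0#

  eval-binomial : ∀ n x → eval (binomial n) x ≈ x ^ suc n ⊕ ⊖ 1#
  eval-binomial n x = ≈-trans (+-comm _ _) (+-congʳ (*-congˡ (power n)))
    where
    power : ∀ n → eval (replicate n 0#) x ≈ x ^ n
    power zero    = ≈-refl
    power (suc n) = ≈-trans (+-identityˡ _) (*-congˡ (power n))

  Δᴷ : ℕ → Seq → Seq
  Δᴷ m f z = f (z ℤ.- + m) ⊕ ⊖ f z

  Δᴷ-cong : ∀ m {f g} → f ≋ g → Δᴷ m f ≋ Δᴷ m g
  Δᴷ-cong m f≋g z = +-cong (f≋g _) (-‿cong (f≋g z))

  private
    z-1-n : ∀ z n → z ℤ.- 1ℤ ℤ.- + n ≡ z ℤ.- + suc n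
    z-1-n z n = identity z (+ n)
      where
      identity : ∀ z n → z ℤ.- 1ℤ ℤ.- n ≡ z ℤ.- (1ℤ ℤ.+ n)
      identity = solve-∀

  act-binomial : ∀ n f → act (binomial n) f ≋ Δᴷ (suc n) f
  act-binomial n f z = ≈-trans (+-comm _ _)
    (+-cong (≈-trans (shifted n (z ℤ.- 1ℤ)) (reflexive (cong f (z-1-n z n)))) (-1*x≈-x (f z)))
    where
    shifted : ∀ n z → act (replicate n 0#) f z ≈ f (z ℤ.- + n)
    shifted zero    z = reflexive (cong f (sym (ℤ.+-identityʳ z)))
    shifted (suc n) z = begin
      0# ⊗ f z ⊕ act (replicate n 0#) f (z ℤ.- 1ℤ)  ≈⟨ +-cong (zeroˡ _) (shifted n (z ℤ.- 1ℤ)) ⟩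
      0# ⊕ f (z ℤ.- 1ℤ ℤ.- + n)                     ≈⟨ +-identityˡ _ ⟩
      f (z ℤ.- 1ℤ ℤ.- + n)                          ≡⟨ cong f (z-1-n z n) ⟩
      f (z ℤ.- + suc n)                             ∎

  ext : Poly → Seq
  ext g (+ n)    = coeff g n
  ext g -[1+ _ ] = 0#

  δᴷ : Seq
  δᴷ (+ zero)  = 1#
  δᴷ (+ suc _) = 0#
  δᴷ -[1+ _ ]  = 0#

  coeff-map : ∀ b g n → coeff (map (b ⊗_) g) n ≈ b ⊗ coeff g n
  coeff-map b []      n       = ≈-sym (zeroʳ b)
  coeff-map b (x ∷ g) zero    = ≈-refl
  coeff-map b (x ∷ g) (suc n) = coeff-map b g n

  coeff-+ₚ : ∀ f g n → coeff (f +ₚ g) n ≈ coeff f n ⊕ coeff g n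
  coeff-+ₚ []      g       n       = ≈-sym (+-identityˡ _)
  coeff-+ₚ (x ∷ f) []      n       = ≈-sym (+-identityʳ _)
  coeff-+ₚ (x ∷ f) (y ∷ g) zero    = ≈-refl
  coeff-+ₚ (x ∷ f) (y ∷ g) (suc n) = coeff-+ₚ f g n

  ext-times : ∀ b g → ext ((x- b) *ₚ g) ≋ times b (ext g)
  ext-times b g -[1+ n ]  = ≈-sym (≈-trans (+-identityˡ _) (zeroʳ _))
  ext-times b g (+ zero)  = begin
    coeff ((x- b) *ₚ g) 0           ≈⟨ coeff-+ₚ (map (⊖ b ⊗_) g) _ 0 ⟩
    coeff (map (⊖ b ⊗_) g) 0 ⊕ 0#   ≈⟨ +-comm _ _ ⟩
    0# ⊕ coeff (map (⊖ b ⊗_) g) 0   ≈⟨ +-congˡ (coeff-map (⊖ b) g 0) ⟩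
    0# ⊕ ⊖ b ⊗ coeff g 0            ∎
  ext-times b g (+ suc n) = begin
    coeff ((x- b) *ₚ g) (suc n)                                             ≈⟨ coeff-+ₚ (map (⊖ b ⊗_) g) _ (suc n) ⟩
    coeff (map (⊖ b ⊗_) g) (suc n) ⊕ coeff (map (1# ⊗_) g +ₚ (0# ∷ [])) n  ≈⟨ +-cong (coeff-map (⊖ b) g (suc n)) (coeff-+ₚ (map (1# ⊗_) g) _ n) ⟩
    ⊖ b ⊗ coeff g (suc n) ⊕ (coeff (map (1# ⊗_) g) n ⊕ coeff (0# ∷ []) n)  ≈⟨ +-congˡ (+-cong (≈-trans (coeff-map 1# g n) (*-identityˡ _)) (zeros n)) ⟩
    ⊖ b ⊗ coeff g (suc n) ⊕ (coeff g n ⊕ 0#)                                ≈⟨ ≈-trans (+-congˡ (+-identityʳ _)) (+-comm _ _) ⟩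
    coeff g n ⊕ ⊖ b ⊗ coeff g (suc n)                                       ∎
    where
    zeros : ∀ n → coeff (0# ∷ []) n ≈ 0#
    zeros zero    = ≈-refl
    zeros (suc n) = ≈-refl

  ext-[1] : ext [ 1# ] ≋ δᴷ
  ext-[1] (+ zero)  = ≈-refl
  ext-[1] (+ suc _) = ≈-refl
  ext-[1] -[1+ _ ]  = ≈-refl

  times-degree : ∀ b {f n} → (∀ {m} → n < m → f (+ m) ≈ 0#) → ∀ {m} → suc n < m → times b f (+ m) ≈ 0#
  times-degree b zero-above {suc m} (s≤s n<m) = ≈-trans
    (+-cong (zero-above n<m) (≈-trans (*-congˡ (zero-above (ℕ.m<n⇒m<1+n n<m))) (zeroʳ _))) (+-identityʳ _)

  Δᴷ-injective : ∀ m .{{_ : NonZero m}} {f g} → (∀ n → f -[1+ n ] ≈ g -[1+ n ]) → Δᴷ m f ≋ Δᴷ m g → f ≋ g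
  Δᴷ-injective m@(suc m′) {f} {g} negative Δf≋Δg -[1+ n ] = negative n
  Δᴷ-injective m@(suc m′) {f} {g} negative Δf≋Δg (+ n)    = go n n ℕ.≤-refl
    where
    advance : ∀ z → f (z ℤ.- + m) ≈ g (z ℤ.- + m) → f z ≈ g z
    advance z eq = -‿injective (+ᴷ-cancelˡ (f (z ℤ.- + m)) _ _ (≈-trans (Δf≋Δg z) (+-congʳ (≈-sym eq))))
    go : ∀ b n → n ≤ b → f (+ n) ≈ g (+ n)
    go b n n≤b with + n ℤ.- + m in eq
    ... | -[1+ k ] = advance (+ n) (subst (λ z → f z ≈ g z) (sym eq) (negative k))
    go zero    zero    n≤b | + k with () ← eq
    go (suc b) zero    n≤b | + k with () ← eq
    go (suc b) (suc n) (s≤s n≤b) | + k = advance (+ suc n) (subst (λ z → f z ≈ g z) (sym eq)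
      (go b k (ℕ.≤-trans (ℤ.drop‿+≤+ (subst (ℤ._≤ + n) (trans (identity (+ n) (+ m′)) eq) (ℤ.i-j≤i (+ n) (+ m′)))) n≤b)))
      where
      identity : ∀ n m → n ℤ.- m ≡ (1ℤ ℤ.+ n) ℤ.- (1ℤ ℤ.+ m)
      identity = solve-∀

  module Roots (ζ : Carrier) where

    product : (ℕ → ℕ) → ℕ → Seq → Seq
    product e zero    f = f
    product e (suc n) f = timesⁿ (e n) (ζ ^ n) (product e n f)

    product-cong : ∀ e n {f g} → f ≋ g → product e n f ≋ product e n g
    product-cong e zero    f≋g = f≋g
    product-cong e (suc n) f≋g = timesⁿ-cong (e n) (ζ ^ n) (product-cong e n f≋g)

    product-≗ : ∀ {e e′} n f → (∀ {k} → k < n → e k ≡ e′ k) → product e n f ≋ product e′ n f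
    product-≗ zero    f e≗e′ z = ≈-refl
    product-≗ {e} {e′} (suc n) f e≗e′ z = ≈-trans
      (reflexive (cong (λ i → timesⁿ i (ζ ^ n) (product e n f) z) (e≗e′ ℕ.≤-refl)))
      (timesⁿ-cong (e′ n) (ζ ^ n) (product-≗ n f λ k<n → e≗e′ (ℕ.m<n⇒m<1+n k<n)) z)

    times-product : ∀ b e n f → times b (product e n f) ≋ product e n (times b f)
    times-product b e zero    f z = ≈-refl
    times-product b e (suc n) f z = ≈-trans (times-timesⁿ b (e n) (ζ ^ n) (product e n f) z)
      (timesⁿ-cong (e n) (ζ ^ n) (times-product b e n f) z)

    timesⁿ-product : ∀ i b e n f → timesⁿ i b (product e n f) ≋ product e n (timesⁿ i b f)
    timesⁿ-product zero    b e n f z = ≈-refl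
    timesⁿ-product (suc i) b e n f z = ≈-trans (times-cong b (timesⁿ-product i b e n f) z) (times-product b e n (timesⁿ i b f) z)

    product-+ : ∀ e e′ n f → product e n (product e′ n f) ≋ product (λ k → e k + e′ k) n f
    product-+ e e′ zero    f z = ≈-refl
    product-+ e e′ (suc n) f z = begin
      timesⁿ (e n) b (product e n (timesⁿ (e′ n) b (product e′ n f))) z  ≈⟨ timesⁿ-cong (e n) b (timesⁿ-product (e′ n) b e n (product e′ n f)) z ⟨
      timesⁿ (e n) b (timesⁿ (e′ n) b (product e n (product e′ n f))) z  ≈⟨ timesⁿ-+ (e n) (e′ n) b _ z ⟩
      timesⁿ (e n + e′ n) b (product e n (product e′ n f)) z             ≈⟨ timesⁿ-cong (e n + e′ n) b (product-+ e e′ n f) z ⟩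
      timesⁿ (e n + e′ n) b (product (λ k → e k + e′ k) n f) z           ∎
      where
      b : Carrier
      b = ζ ^ n

    timesAll : List ℕ → Seq → Seq
    timesAll ks f = foldr (λ k → times (ζ ^ k)) f ks

    timesAll-cong : ∀ ks {f g} → f ≋ g → timesAll ks f ≋ timesAll ks g
    timesAll-cong []       f≋g = f≋g
    timesAll-cong (k ∷ ks) f≋g = times-cong (ζ ^ k) (timesAll-cong ks f≋g)

    times-timesAll : ∀ b ks f → times b (timesAll ks f) ≋ timesAll ks (times b f)
    times-timesAll b []       f z = ≈-refl
    times-timesAll b (k ∷ ks) f z = ≈-trans (times-comm b (ζ ^ k) (timesAll ks f) z)
      (times-cong (ζ ^ k) (times-timesAll b ks f) z)

    timesAll-filter : ∀ {P : Pred ℕ 0ℓ} (P? : Decidable P) n f →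
      timesAll (filter P? (upTo n)) f ≋ product (λ k → indicator (P? k)) n f
    timesAll-filter P? zero    f z = ≈-refl
    timesAll-filter P? (suc n) f z = ≈-trans (reflexive (cong (λ g → g z) split)) rest
      where
      split : timesAll (filter P? (upTo (suc n))) f ≡ timesAll (filter P? (upTo n)) (timesAll (filter P? [ n ]) f)
      split = trans
        (cong (λ ks → timesAll ks f) (trans (cong (filter P?) (sym (List.upTo-∷ʳ n))) (List.filter-++ P? (upTo n) [ n ])))
        (List.foldr-++ (λ k → times (ζ ^ k)) f (filter P? (upTo n)) (filter P? [ n ]))
      rest : timesAll (filter P? (upTo n)) (timesAll (filter P? [ n ]) f) z ≈
             timesⁿ (indicator (P? n)) (ζ ^ n) (product (λ k → indicator (P? k)) n f) z
      rest with P? n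
      ... | no _  = timesAll-filter P? n f z
      ... | yes _ = ≈-trans (≈-sym (times-timesAll (ζ ^ n) (filter P? (upTo n)) f z))
        (times-cong (ζ ^ n) (timesAll-filter P? n f) z)

    ext-∏ : ∀ ks → ext (∏ₚ (map (λ k → x- (ζ ^ k)) ks)) ≋ timesAll ks δᴷ
    ext-∏ []       = ext-[1]
    ext-∏ (k ∷ ks) z = ≈-trans (ext-times (ζ ^ k) _ z) (times-cong (ζ ^ k) (ext-∏ ks) z)

    timesAll-degree : ∀ ks {m} → length ks < m → timesAll ks δᴷ (+ m) ≈ 0#
    timesAll-degree []       (s≤s z≤n) = ≈-refl
    timesAll-degree (k ∷ ks) len<m     = times-degree (ζ ^ k) {timesAll ks δᴷ} (timesAll-degree ks) len<m

    module Primitive (N : ℕ) (isPrimitive : IsPrimitiveRoot N ζ) where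
      open IsPrimitiveRoot isPrimitive

      distinct : ∀ {i j} → i < j → j < N → ¬ (ζ ^ i ≈ ζ ^ j)
      distinct {i} {j} i<j j<N ζⁱ≈ζʲ = minimal (j ∸ i) (ℕ.m<n⇒0<n∸m i<j) (ℕ.≤-<-trans (ℕ.m∸n≤m j i) j<N) (begin
        ζ ^ (j ∸ i)                        ≈⟨ *-identityˡ _ ⟨
        1# ⊗ ζ ^ (j ∸ i)                   ≈⟨ *-congʳ invert ⟨
        ζ ^ (N ∸ i) ⊗ ζ ^ i ⊗ ζ ^ (j ∸ i)  ≈⟨ *-assoc _ _ _ ⟩
        ζ ^ (N ∸ i) ⊗ (ζ ^ i ⊗ ζ ^ (j ∸ i)) ≈⟨ *-congˡ (^-homo-* ζ i (j ∸ i)) ⟨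
        ζ ^ (N ∸ i) ⊗ ζ ^ (i + (j ∸ i))    ≡⟨ cong (λ k → ζ ^ (N ∸ i) ⊗ ζ ^ k) (ℕ.m+[n∸m]≡n (ℕ.<⇒≤ i<j)) ⟩
        ζ ^ (N ∸ i) ⊗ ζ ^ j                ≈⟨ *-congˡ ζⁱ≈ζʲ ⟨
        ζ ^ (N ∸ i) ⊗ ζ ^ i                ≈⟨ invert ⟩
        1#                                 ∎)
        where
        invert : ζ ^ (N ∸ i) ⊗ ζ ^ i ≈ 1#
        invert = begin
          ζ ^ (N ∸ i) ⊗ ζ ^ i  ≈⟨ ^-homo-* ζ (N ∸ i) i ⟨
          ζ ^ (N ∸ i + i)      ≡⟨ cong (ζ ^_) (ℕ.m∸n+n≡m (ℕ.<⇒≤ (ℕ.<-trans i<j j<N))) ⟩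
          ζ ^ N                ≈⟨ root ⟩
          1#                   ∎

      product-monic : ∀ {P : Pred ℕ 0ℓ} (P? : Decidable P) n {d} (g : Monic d) f → n ≤ N → count P? n ≡ d →
        (∀ {k} → k < n → P k → eval g (ζ ^ k) ≈ 0#) → product (λ k → indicator (P? k)) n f ≋ act g f
      product-monic P? zero    []      f n≤N _ vanish z = ≈-refl
      product-monic P? (suc n) g f n<N count≡ vanish z with P? n
      ... | no _ = product-monic P? n g f (ℕ.<⇒≤ n<N) (trans (sym (ℕ.+-identityʳ _)) count≡) (λ k<n → vanish (ℕ.m<n⇒m<1+n k<n)) z
      ... | yes Pn with g | trans (ℕ.+-comm 1 (count P? n)) count≡
      ... | g@(_ ∷ _) | refl = begin
        times (ζ ^ n) (product (λ k → indicator (P? k)) n f) z        ≈⟨ times-cong (ζ ^ n) (product-monic P? n (quotient g (ζ ^ n)) f (ℕ.<⇒≤ n<N) refl vanish′) z ⟩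
        times (ζ ^ n) (act (quotient g (ζ ^ n)) f) z                  ≈⟨ +-identityʳ _ ⟨
        times (ζ ^ n) (act (quotient g (ζ ^ n)) f) z ⊕ 0#             ≈⟨ +-congˡ (≈-trans (*-congʳ (vanish ℕ.≤-refl Pn)) (zeroˡ (f z))) ⟨
        times (ζ ^ n) (act (quotient g (ζ ^ n)) f) z ⊕ eval g (ζ ^ n) ⊗ f z ≈⟨ act-quotient g (ζ ^ n) f z ⟨
        act g f z                                                     ∎
        where
        vanish′ : ∀ {k} → k < n → _ → eval (quotient g (ζ ^ n)) (ζ ^ k) ≈ 0#
        vanish′ {k} k<n Pk = integral (λ eq → distinct k<n n<N (x∙y⁻¹≈ε⇒x≈y _ _ eq)) (begin
          (ζ ^ k ⊕ ⊖ (ζ ^ n)) ⊗ eval (quotient g (ζ ^ n)) (ζ ^ k)                   ≈⟨ +-identityʳ _ ⟨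
          (ζ ^ k ⊕ ⊖ (ζ ^ n)) ⊗ eval (quotient g (ζ ^ n)) (ζ ^ k) ⊕ 0#              ≈⟨ +-congˡ (vanish ℕ.≤-refl Pn) ⟨
          (ζ ^ k ⊕ ⊖ (ζ ^ n)) ⊗ eval (quotient g (ζ ^ n)) (ζ ^ k) ⊕ eval g (ζ ^ n)  ≈⟨ eval-quotient g (ζ ^ n) (ζ ^ k) ⟨
          eval g (ζ ^ k)                                                            ≈⟨ vanish (ℕ.m<n⇒m<1+n k<n) Pk ⟩
          0#                                                                        ∎)

      product-multiples : ∀ d m .{{_ : NonZero d}} .{{_ : NonZero m}} → d * m ≡ N → ∀ f →
        product (λ k → indicator (d ∣? k)) N f ≋ Δᴷ m f
      product-multiples d (suc m) dm≡N f z = ≈-trans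
        (product-monic (d ∣?_) N (binomial m) f ℕ.≤-refl (trans (cong (count (d ∣?_)) (sym dm≡N)) (count-multiples d (suc m)))
          (λ {k} _ d∣k → ≈-trans (eval-binomial m (ζ ^ k)) (≈-trans (+-congʳ (root-of-unity d∣k)) (-‿inverseʳ 1#))) z)
        (act-binomial m f z)
        where
        one^ : ∀ n → 1# ^ n ≈ 1#
        one^ zero    = ≈-refl
        one^ (suc n) = ≈-trans (*-identityˡ _) (one^ n)
        root-of-unity : ∀ {k} → d ∣ k → (ζ ^ k) ^ suc m ≈ 1#
        root-of-unity {k} (divides j k≡jd) = begin
          (ζ ^ k) ^ suc m   ≈⟨ ^-assocʳ ζ k (suc m) ⟩
          ζ ^ (k * suc m)   ≡⟨ cong (ζ ^_) (trans (cong (_* suc m) k≡jd)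
                                (trans (ℕ.*-assoc j d (suc m)) (trans (cong (j *_) dm≡N) (ℕ.*-comm j N)))) ⟩
          ζ ^ (N * j)       ≈⟨ ^-assocʳ ζ N j ⟨
          (ζ ^ N) ^ j       ≈⟨ ^-congˡ j root ⟩
          1# ^ j            ≈⟨ one^ j ⟩
          1#                ∎

module _ {a : ℕ → ℤ} (N : ℕ) (vanishes : ∀ {n} → N ≤ n → a n ≡ 0ℤ) where

  private
    largest : ∀ b → ∃[ n ] (∀ {m} → m < b → a m ℤ.≤ a n) × a N ℤ.≤ a n
    largest zero    = N , (λ ()) , ℤ.≤-refl
    largest (suc b) with largest b
    ... | n , above , aN≤ with ℤ.≤-total (a b) (a n)
    ... | inj₁ ab≤an = n , extend , aN≤
      where
      extend : ∀ {m} → m < suc b → a m ℤ.≤ a n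
      extend m<1+b with ℕ.m<1+n⇒m<n∨m≡n m<1+b
      ... | inj₁ m<b  = above m<b
      ... | inj₂ refl = ab≤an
    ... | inj₂ an≤ab = b , extend , ℤ.≤-trans aN≤ an≤ab
      where
      extend : ∀ {m} → m < suc b → a m ℤ.≤ a b
      extend m<1+b with ℕ.m<1+n⇒m<n∨m≡n m<1+b
      ... | inj₁ m<b  = ℤ.≤-trans (above m<b) an≤ab
      ... | inj₂ refl = ℤ.≤-refl

  maximum : ∃[ n ] IsMaximum a (a n)
  maximum with largest N
  ... | n , above , aN≤ = n , record { attained = n , refl ; bound = everywhere }
    where
    everywhere : ∀ m → a m ℤ.≤ a n
    everywhere m with m ℕ.<? N
    ... | yes m<N = above m<N
    ... | no  m≮N = ℤ.≤-trans (ℤ.≤-reflexive (trans (vanishes (ℕ.≮⇒≥ m≮N)) (sym (vanishes ℕ.≤-refl)))) aN≤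

minimum : ∀ {a : ℕ → ℤ} N → (∀ {n} → N ≤ n → a n ≡ 0ℤ) → ∃[ n ] IsMinimum a (a n)
minimum {a} N vanishes with maximum {λ n → ℤ.- a n} N (λ N≤n → cong ℤ.-_ (vanishes N≤n))
... | n , isMaximum = n , record { attained = n , refl ; bound = λ m → ℤ.neg-cancel-≤ (IsMaximum.bound isMaximum m) }

module _ {p u v : ℕ} (u<p : u < p) (v<p : v < p) (u≤v : u ≤ v) where

  sizes-small : u + v ≤ p →
    (u + (p ∸ (u + v)) ≡ p ∸ v) × (u + (u + v) ≡ 2 * u + v) ×
    (u + v ∸ v + (v ∸ u) ≡ v) × (u + v ∸ v + (u + (p ∸ v)) ≡ p + 2 * u ∸ v)
  sizes-small u+v≤p =
    (begin
      u + (p ∸ (u + v))   ≡⟨ ℕ.+-∸-assoc u u+v≤p ⟨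
      u + p ∸ (u + v)     ≡⟨ ℕ.[m+n]∸[m+o]≡n∸o u p v ⟩
      p ∸ v               ∎) ,
    double u v ,
    trans (cong (_+ (v ∸ u)) (ℕ.m+n∸n≡m u v)) (ℕ.m+[n∸m]≡n u≤v) ,
    (begin
      u + v ∸ v + (u + (p ∸ v))  ≡⟨ cong (_+ (u + (p ∸ v))) (ℕ.m+n∸n≡m u v) ⟩
      u + (u + (p ∸ v))          ≡⟨ regroup u (p ∸ v) ⟩
      2 * u + (p ∸ v)            ≡⟨ ℕ.+-∸-assoc (2 * u) (ℕ.<⇒≤ v<p) ⟨
      2 * u + p ∸ v              ≡⟨ cong (_∸ v) (ℕ.+-comm (2 * u) p) ⟩
      p + 2 * u ∸ v              ∎)
    where
    open ≡-Reasoning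
    double : ∀ u v → u + (u + v) ≡ 2 * u + v
    double = ℕ-Solver.solve-∀
    regroup : ∀ u d → u + (u + d) ≡ 2 * u + d
    regroup = ℕ-Solver.solve-∀

  sizes-large : p ≤ u + v →
    (u ∸ (u + v ∸ p) + (u + v ∸ p) ≡ p ∸ (p ∸ u)) ×
    (u ∸ (u + v ∸ p) + (p ∸ u + (p ∸ v)) ≡ 2 * (p ∸ v) + (p ∸ u)) ×
    (p ∸ v + (v ∸ u) ≡ p ∸ u) × (p ∸ v + (u + (p ∸ v)) ≡ p + 2 * (p ∸ v) ∸ (p ∸ u))
  sizes-large p≤u+v =
    trans (ℕ.m∸n+n≡m b≤u) (sym (ℕ.m∸[m∸n]≡n (ℕ.<⇒≤ u<p))) ,
    trans (cong (_+ (p ∸ u + (p ∸ v))) u∸b≡) (regroup (p ∸ v) (p ∸ u)) ,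
    (begin
      p ∸ v + (v ∸ u)    ≡⟨ ℕ.+-∸-assoc (p ∸ v) u≤v ⟨
      p ∸ v + v ∸ u      ≡⟨ cong (_∸ u) (ℕ.m∸n+n≡m (ℕ.<⇒≤ v<p)) ⟩
      p ∸ u              ∎) ,
    (begin
      p ∸ v + (u + (p ∸ v))                  ≡⟨ regroup′ (p ∸ v) u ⟩
      u + 2 * (p ∸ v)                        ≡⟨ ℕ.m+n∸m≡n (p ∸ u) _ ⟨
      p ∸ u + (u + 2 * (p ∸ v)) ∸ (p ∸ u)    ≡⟨ cong (_∸ (p ∸ u)) (trans (sym (ℕ.+-assoc (p ∸ u) u _))
                                                  (cong (_+ 2 * (p ∸ v)) (ℕ.m∸n+n≡m (ℕ.<⇒≤ u<p)))) ⟩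
      p + 2 * (p ∸ v) ∸ (p ∸ u)              ∎)
    where
    open ≡-Reasoning
    regroup : ∀ a d → a + (d + a) ≡ 2 * a + d
    regroup = ℕ-Solver.solve-∀
    regroup′ : ∀ a u → a + (u + a) ≡ u + 2 * a
    regroup′ = ℕ-Solver.solve-∀
    b≤u : u + v ∸ p ≤ u
    b≤u = ℕ.m≤n+o⇒m∸n≤o (u + v) p (subst (u + v ≤_) (ℕ.+-comm u p) (ℕ.+-monoʳ-≤ u (ℕ.<⇒≤ v<p)))
    u∸b≡ : u ∸ (u + v ∸ p) ≡ p ∸ v
    u∸b≡ = ℕ.+-cancelʳ-≡ (u + v ∸ p) _ _ (trans (ℕ.m∸n+n≡m b≤u) (ℕ.+-cancelʳ-≡ v _ _ (begin
      u + v                        ≡⟨ ℕ.m+[n∸m]≡n p≤u+v ⟨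
      p + (u + v ∸ p)              ≡⟨ cong (_+ (u + v ∸ p)) (ℕ.m∸n+n≡m (ℕ.<⇒≤ v<p)) ⟨
      p ∸ v + v + (u + v ∸ p)      ≡⟨ swap (p ∸ v) v (u + v ∸ p) ⟩
      p ∸ v + (u + v ∸ p) + v      ∎)))
      where
      swap : ∀ a v b → a + v + b ≡ a + b + v
      swap = ℕ-Solver.solve-∀

  α-small : u + v ≤ p → u ⊓ v ⊓ (p ∸ u) ⊓ (p ∸ v) ≡ u
  α-small u+v≤p = begin
    u ⊓ v ⊓ (p ∸ u) ⊓ (p ∸ v)  ≡⟨ cong (λ m → m ⊓ (p ∸ u) ⊓ (p ∸ v)) (ℕ.m≤n⇒m⊓n≡m u≤v) ⟩
    u ⊓ (p ∸ u) ⊓ (p ∸ v)      ≡⟨ cong (_⊓ (p ∸ v)) (ℕ.m≤n⇒m⊓n≡m (ℕ.m+n≤o⇒m≤o∸n u (ℕ.≤-trans (ℕ.+-monoʳ-≤ u u≤v) u+v≤p))) ⟩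
    u ⊓ (p ∸ v)                ≡⟨ ℕ.m≤n⇒m⊓n≡m (ℕ.m+n≤o⇒m≤o∸n u u+v≤p) ⟩
    u                          ∎
    where open ≡-Reasoning

  α-large : p ≤ u + v → u ⊓ v ⊓ (p ∸ u) ⊓ (p ∸ v) ≡ p ∸ v
  α-large p≤u+v = ℕ.m≥n⇒m⊓n≡n (ℕ.⊓-glb
    (ℕ.≤-trans p∸v≤u (ℕ.≤-reflexive (sym (ℕ.m≤n⇒m⊓n≡m u≤v)))) (ℕ.∸-monoʳ-≤ p u≤v))
    where
    p∸v≤u : p ∸ v ≤ u
    p∸v≤u = ℕ.m≤n+o⇒m∸n≤o p v (subst (p ≤_) (ℕ.+-comm u v) p≤u+v)

module Agreement {c ℓ₁ ℓ₂} (K : HeytingField c ℓ₁ ℓ₂) {p q r : ℕ} .{{_ : NonZero p}} .{{_ : NonZero q}} .{{_ : NonZero r}}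
  (prp : Prime p) (prq : Prime q) (prr : Prime r) (p<q : p < q) (p<r : p < r) (q≢r : q ≢ r)
  (ζ : HeytingField.Carrier K) (isPrimitive : Cyclotomic.IsPrimitiveRoot K (p * q * r) ζ)
  {u v w x : ℕ} (u<p : u < p) (v<p : v < p) (qu≡1+pw : q * u ≡ 1 + p * w) (rv≡1+px : r * v ≡ 1 + p * x) where

  open HeytingField K using (_≈_; 0#; heytingCommutativeRing)
  open CommutativeRing (HeytingCommutativeRing.commutativeRing heytingCommutativeRing) using ()
    renaming (refl to ≈-refl; sym to ≈-sym; trans to ≈-trans; reflexive to ≈-reflexive; +-cong to +ᴷ-cong; -‿inverseʳ to -ᴷ-inverseʳ)
  open Cyclotomic K
  open Sequences K
  open Roots ζ

  N : ℕ
  N = p * q * r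

  open Primitive N isPrimitive

  q⊥r : Coprime q r
  q⊥r = primes-coprime prq prr q≢r
  p⊥q : Coprime p q
  p⊥q = primes-coprime prp prq (ℕ.<⇒≢ p<q)
  p⊥r : Coprime p r
  p⊥r = primes-coprime prp prr (ℕ.<⇒≢ p<r)
  qr⊥p : Coprime (q * r) p
  qr⊥p = coprime-*ˡ (Coprimality.sym p⊥q) (Coprimality.sym p⊥r)

  open Coefficient p q r qr⊥p (Coprimality.sym q⊥r) (1<prime prp) p<q p<r u<p v<p qu≡1+pw rv≡1+px public
    using (Δ-c; Δ-a; a-negative; a; coefficient-small; coefficient-large) renaming (c to semigroup)
  open Exponents prp prq prr p⊥q p⊥r q⊥r

  instance
    pq≢0 : NonZero (p * q)
    pq≢0 = ℕ.m*n≢0 p q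
    pr≢0 : NonZero (p * r)
    pr≢0 = ℕ.m*n≢0 p r
    qr≢0 : NonZero (q * r)
    qr≢0 = ℕ.m*n≢0 q r
    N≢0 : NonZero N
    N≢0 = ℕ.m*n≢0 (p * q) r

  E : ℕ → ℕ → ℕ
  E d k = indicator (d ∣? k)

  ≋-trans : ∀ {f g h : Seq} → f ≋ g → g ≋ h → f ≋ h
  ≋-trans f≋g g≋h z = ≈-trans (f≋g z) (g≋h z)

  ≋-sym : ∀ {f g : Seq} → f ≋ g → g ≋ f
  ≋-sym f≋g z = ≈-sym (f≋g z)

  merge : ∀ d m .{{_ : NonZero d}} .{{_ : NonZero m}} → d * m ≡ N → ∀ e f {g} →
    g ≋ product e N f → Δᴷ m g ≋ product (λ k → E d k + e k) N f
  merge d m dm≡N e f {g} g≋ = ≋-trans (Δᴷ-cong m g≋)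
    (≋-trans (≋-sym (product-multiples d m dm≡N (product e N f))) (product-+ (E d) e N f))

  start : ∀ d m .{{_ : NonZero d}} .{{_ : NonZero m}} → d * m ≡ N → ∀ f → Δᴷ m f ≋ product (E d) N f
  start d m dm≡N f = ≋-sym (product-multiples d m dm≡N f)

  p*qr : p * (q * r) ≡ N
  p*qr = sym (ℕ.*-assoc p q r)
  q*pr : q * (p * r) ≡ N
  q*pr = identity p q r
    where
    identity : ∀ p q r → q * (p * r) ≡ p * q * r
    identity = ℕ-Solver.solve-∀
  r*pq : r * (p * q) ≡ N
  r*pq = ℕ.*-comm r (p * q)
  qr*p : q * r * p ≡ N
  qr*p = trans (ℕ.*-comm (q * r) p) p*qr
  pr*q : p * r * q ≡ N
  pr*q = trans (ℕ.*-comm (p * r) q) q*pr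

  φ : Seq
  φ = ext (Φ N ζ)

  φ≋timesAll : φ ≋ timesAll (units N) δᴷ
  φ≋timesAll = ext-∏ (units N)

  φ≋product : φ ≋ product (λ k → indicator (isUnit? N k)) N δᴷ
  φ≋product = ≋-trans φ≋timesAll (timesAll-filter (isUnit? N) N δᴷ)

  cyclotomic-identity : Δᴷ (q * r) (Δᴷ (p * r) (Δᴷ (p * q) (Δᴷ 1 φ))) ≋ Δᴷ p (Δᴷ q (Δᴷ r (Δᴷ N δᴷ)))
  cyclotomic-identity = ≋-trans
    (merge p (q * r) p*qr _ δᴷ (merge q (p * r) q*pr _ δᴷ (merge r (p * q) r*pq _ δᴷ
      (merge N 1 (ℕ.*-identityʳ N) _ δᴷ φ≋product))))
    (≋-trans (product-≗ N δᴷ (λ {k} _ → exponents k))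
      (≋-sym (merge (q * r) p qr*p _ δᴷ (merge (p * r) q pr*q _ δᴷ (merge (p * q) r refl _ δᴷ
        (start 1 N (ℕ.*-identityˡ N) δᴷ))))))

  reorder : ∀ f → Δᴷ p (Δᴷ q (Δᴷ r (Δᴷ (p * q) (Δᴷ (p * r) (Δᴷ (q * r) f))))) ≋
                  Δᴷ (q * r) (Δᴷ (p * r) (Δᴷ (p * q) (Δᴷ p (Δᴷ q (Δᴷ r f)))))
  reorder f = ≋-trans
    (merge (q * r) p qr*p _ f (merge (p * r) q pr*q _ f (merge (p * q) r refl _ f
      (merge r (p * q) r*pq _ f (merge q (p * r) q*pr _ f (start p (q * r) p*qr f))))))
    (≋-trans (product-≗ N f (λ {k} _ → identity (E (q * r) k) (E (p * r) k) (E (p * q) k) (E r k) (E q k) (E p k)))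
      (≋-sym (merge p (q * r) p*qr _ f (merge q (p * r) q*pr _ f (merge r (p * q) r*pq _ f
        (merge (q * r) p qr*p _ f (merge (p * r) q pr*q _ f (start (p * q) r refl f))))))))
    where
    identity : ∀ a b c d e f → a + (b + (c + (d + (e + f)))) ≡ f + (e + (d + (a + (b + c))))
    identity = ℕ-Solver.solve-∀

  fromℤ-Δ : ∀ m f → (λ z → fromℤ (Δ m f z)) ≋ Δᴷ m (λ z → fromℤ (f z))
  fromℤ-Δ m f z = fromℤ-- (f (z ℤ.- + m)) (f z)

  fromℤ-Δ³ : ∀ l m n f → (λ z → fromℤ (Δ l (Δ m (Δ n f)) z)) ≋ Δᴷ l (Δᴷ m (Δᴷ n (λ z → fromℤ (f z))))
  fromℤ-Δ³ l m n f z = ≈-trans (fromℤ-Δ l (Δ m (Δ n f)) z)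
    (Δᴷ-cong l {λ z → fromℤ (Δ m (Δ n f) z)} (λ z → ≈-trans (fromℤ-Δ m (Δ n f) z)
      (Δᴷ-cong m {λ z → fromℤ (Δ n f z)} (fromℤ-Δ n f) z)) z)

  δᴷ≋fromℤ-δ : δᴷ ≋ (λ z → fromℤ (δ z))
  δᴷ≋fromℤ-δ (+ zero)  = ≈-sym fromℤ-1
  δᴷ≋fromℤ-δ (+ suc _) = ≈-refl
  δᴷ≋fromℤ-δ -[1+ _ ]  = ≈-refl

  A : Seq
  A z = fromℤ (a z)

  S : Seq
  S z = fromℤ (semigroup z)

  Δ-S : Δᴷ N δᴷ ≋ Δᴷ (p * q) (Δᴷ (p * r) (Δᴷ (q * r) S))
  Δ-S z = ≈-trans (Δᴷ-cong N δᴷ≋fromℤ-δ z) (≈-trans (≈-sym (fromℤ-Δ N δ z))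
    (≈-trans (≈-reflexive (cong fromℤ (sym (Δ-c z)))) (fromℤ-Δ³ (p * q) (p * r) (q * r) semigroup z)))

  Δ-A : Δᴷ 1 A ≋ Δᴷ p (Δᴷ q (Δᴷ r S))
  Δ-A z = ≈-trans (≈-sym (fromℤ-Δ 1 a z)) (≈-trans (≈-reflexive (cong fromℤ (Δ-a z))) (fromℤ-Δ³ p q r semigroup z))

  Vanishing : Seq → Set _
  Vanishing f = ∀ n → f -[1+ n ] ≈ 0#

  Δᴷ-vanishing : ∀ m f → Vanishing f → Vanishing (Δᴷ m f)
  Δᴷ-vanishing zero    f vanish n = -ᴷ-inverseʳ (f -[1+ n ])
  Δᴷ-vanishing (suc m) f vanish n = ≈-trans (+ᴷ-cong (≈-trans (vanish _) (≈-sym (vanish n))) ≈-refl) (-ᴷ-inverseʳ (f -[1+ n ]))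

  φ≋A : φ ≋ A
  φ≋A = cancel 1 {φ} {A} φ₀ A₀
    (cancel (p * q) {Δᴷ 1 φ} {Δᴷ 1 A} (Δ₁ φ φ₀) (Δ₁ A A₀)
    (cancel (p * r) {Δᴷ (p * q) (Δᴷ 1 φ)} {Δᴷ (p * q) (Δᴷ 1 A)} (Δ₂ φ φ₀) (Δ₂ A A₀)
    (cancel (q * r) {Δᴷ (p * r) (Δᴷ (p * q) (Δᴷ 1 φ))} {Δᴷ (p * r) (Δᴷ (p * q) (Δᴷ 1 A))} (Δ₃ φ φ₀) (Δ₃ A A₀)
    (≋-trans cyclotomic-identity (≋-trans (Δᴷ-cong p (Δᴷ-cong q (Δᴷ-cong r Δ-S))) (≋-trans (reorder S)
      (Δᴷ-cong (q * r) (Δᴷ-cong (p * r) (Δᴷ-cong (p * q) (≋-sym Δ-A))))))))))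
    where
    φ₀ : Vanishing φ
    φ₀ n = ≈-refl
    A₀ : Vanishing A
    A₀ n = ≈-reflexive (cong fromℤ (a-negative -<+))
    Δ₁ : ∀ f → Vanishing f → Vanishing (Δᴷ 1 f)
    Δ₁ = Δᴷ-vanishing 1
    Δ₂ : ∀ f → Vanishing f → Vanishing (Δᴷ (p * q) (Δᴷ 1 f))
    Δ₂ f v = Δᴷ-vanishing (p * q) (Δᴷ 1 f) (Δ₁ f v)
    Δ₃ : ∀ f → Vanishing f → Vanishing (Δᴷ (p * r) (Δᴷ (p * q) (Δᴷ 1 f)))
    Δ₃ f v = Δᴷ-vanishing (p * r) (Δᴷ (p * q) (Δᴷ 1 f)) (Δ₂ f v)
    cancel : ∀ m .{{_ : NonZero m}} {f g} → Vanishing f → Vanishing g → Δᴷ m f ≋ Δᴷ m g → f ≋ g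
    cancel m {f} {g} vanish-f vanish-g = Δᴷ-injective m {f} {g} λ n → ≈-trans (vanish-f n) (≈-sym (vanish-g n))

  a-vanishes : CharacteristicZero → ∀ {n} → N ≤ n → a (+ n) ≡ 0ℤ
  a-vanishes char {n} N≤n = fromℤ-injective₀ char (a (+ n)) (≈-trans (≈-sym (φ≋A (+ n)))
    (≈-trans (φ≋timesAll (+ n)) (timesAll-degree (units N) (ℕ.<-≤-trans (length-units< N) N≤n))))

CoefficientBounds : ∀ {c ℓ₁ ℓ₂} (K : HeytingField c ℓ₁ ℓ₂) → ℕ → HeytingField.Carrier K → ℕ → ℕ → Set ℓ₁
CoefficientBounds K n ζ upper lower = ∃[ a ] Cyclotomic.IsCoefficientSequence K (Cyclotomic.Φ K n ζ) a ×
  ∃[ A₊ ] ∃[ A₋ ] IsMaximum a A₊ × IsMinimum a A₋ × (A₊ ℤ.≤ + upper) × (ℤ.- A₋ ℤ.≤ + lower)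

module _ {c ℓ₁ ℓ₂} (K : HeytingField c ℓ₁ ℓ₂) (char0 : Cyclotomic.CharacteristicZero K) where

  ordered-bounds : ∀ {p q r} → Prime p → Prime q → Prime r → q ≢ r → p < q → p < r →
    ∀ ζ → Cyclotomic.IsPrimitiveRoot K (p * q * r) ζ →
    ∀ {u v} → IsInverseMod p q u → IsInverseMod p r v → u ≤ v →
    let α = u ⊓ v ⊓ (p ∸ u) ⊓ (p ∸ v) in
    ∀ {β} → β < p → α * β * q * r ≡ 1 [mod p ] →
    CoefficientBounds K (p * q * r) ζ ((2 * α + β) ⊓ (p ∸ β)) ((p + 2 * α ∸ β) ⊓ β)
  ordered-bounds {p} {q} {r} prp prq prr q≢r p<q p<r ζ isPrimitive {u} {v} inverse-q inverse-r u≤v {β} β<p αβqr≡1 =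
    conclude (ℕ.≤-total (u + v) p)
    where
    instance
      p≢0 : NonZero p
      p≢0 = prime⇒nonZero prp
      q≢0 : NonZero q
      q≢0 = prime⇒nonZero prq
      r≢0 : NonZero r
      r≢0 = prime⇒nonZero prr
    u<p : u < p
    u<p = IsInverseMod.below inverse-q
    v<p : v < p
    v<p = IsInverseMod.below inverse-r
    inverse-mod : ∀ {q u} → Prime q → IsInverseMod p q u → ∃[ w ] q * u ≡ 1 + p * w
    inverse-mod {q} {u} prq inverse = ≡1[mod]⇒ {p} {q * u}
      (ℕ.*-mono-< (ℕ.<-trans (s≤s z≤n) (1<prime prq)) (IsInverseMod.positive inverse)) (IsInverseMod.inverse inverse)
    w : ℕ
    w = proj₁ (inverse-mod prq inverse-q)
    x : ℕ
    x = proj₁ (inverse-mod prr inverse-r)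
    qu≡1+pw : q * u ≡ 1 + p * w
    qu≡1+pw = proj₂ (inverse-mod prq inverse-q)
    rv≡1+px : r * v ≡ 1 + p * x
    rv≡1+px = proj₂ (inverse-mod prr inverse-r)
    α : ℕ
    α = u ⊓ v ⊓ (p ∸ u) ⊓ (p ∸ v)

    open Agreement K prp prq prr p<q p<r q≢r ζ isPrimitive u<p v<p qu≡1+pw rv≡1+px

    Window : ℕ → Set
    Window n = (a (+ n) ℤ.≤ + ((2 * α + β) ⊓ (p ∸ β))) × (ℤ.- a (+ n) ℤ.≤ + ((p + 2 * α ∸ β) ⊓ β))

    from-pairs : ∀ {n k₁ k₂ k₃ k₄} →
      k₁ ≡ p ∸ β → k₂ ≡ 2 * α + β → k₃ ≡ β → k₄ ≡ p + 2 * α ∸ β →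
      ((a (+ n) ℤ.≤ + k₁) × (a (+ n) ℤ.≤ + k₂)) × ((ℤ.- a (+ n) ℤ.≤ + k₃) × (ℤ.- a (+ n) ℤ.≤ + k₄)) → Window n
    from-pairs refl refl refl refl ((a≤₁ , a≤₂) , (-a≤₃ , -a≤₄)) = glb a≤₂ a≤₁ , glb -a≤₄ -a≤₃
      where
      glb : ∀ {y k l} → y ℤ.≤ + k → y ℤ.≤ + l → y ℤ.≤ + (k ⊓ l)
      glb {k = k} {l} y≤k y≤l with ℕ.⊓-sel k l
      ... | inj₁ eq = subst (λ m → _ ℤ.≤ + m) (sym eq) y≤k
      ... | inj₂ eq = subst (λ m → _ ℤ.≤ + m) (sym eq) y≤l

    vanishes : ∀ {n} → N ≤ n → a (+ n) ≡ 0ℤ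
    vanishes = a-vanishes char0

    module _ (windows : ∀ {n} → n < N → Window n) where

      window : ∀ n → Window n
      window n = at (n ℕ.<? N)
        where
        at : Dec (n < N) → Window n
        at (yes n<N) = windows n<N
        at (no  n≮N) = subst (λ y → (y ℤ.≤ + ((2 * α + β) ⊓ (p ∸ β))) × (ℤ.- y ℤ.≤ + ((p + 2 * α ∸ β) ⊓ β)))
          (sym (vanishes (ℕ.≮⇒≥ n≮N))) (+≤+ z≤n , +≤+ z≤n)

      assemble : CoefficientBounds K N ζ ((2 * α + β) ⊓ (p ∸ β)) ((p + 2 * α ∸ β) ⊓ β)
      assemble =
        let m , isMaximum = maximum {λ n → a (+ n)} N vanishes
            n , isMinimum = minimum {λ n → a (+ n)} N vanishes
        in (λ n → a (+ n)) , (λ n → φ≋A (+ n)) , a (+ m) , a (+ n) , isMaximum , isMinimum ,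
          proj₁ (window m) , proj₂ (window n)

    conclude : u + v ≤ p ⊎ p ≤ u + v → CoefficientBounds K N ζ ((2 * α + β) ⊓ (p ∸ β)) ((p + 2 * α ∸ β) ⊓ β)
    conclude (inj₁ u+v≤p) = assemble λ n<N → from-pairs
      (trans (proj₁ sizes) (cong (p ∸_) (sym β≡)))
      (trans (proj₁ (proj₂ sizes)) (sym (cong₂ (λ α β → 2 * α + β) α≡ β≡)))
      (trans (proj₁ (proj₂ (proj₂ sizes))) (sym β≡))
      (trans (proj₂ (proj₂ (proj₂ sizes))) (sym (cong₂ (λ α β → p + 2 * α ∸ β) α≡ β≡)))
      (coefficient-small (+<+ n<N) u≤v u+v≤p)
      where
      sizes = sizes-small u<p v<p u≤v u+v≤p
      α≡ : α ≡ u
      α≡ = α-small u<p v<p u≤v u+v≤p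
      β≡ : β ≡ v
      β≡ = β≡v {p} {q} {r} {u} {v} {w} {x} β<p qu≡1+pw rv≡1+px v<p
        (subst (λ α → α * β * q * r ≡ 1 [mod p ]) α≡ αβqr≡1)
    conclude (inj₂ p≤u+v) = assemble λ n<N → from-pairs
      (trans (proj₁ sizes) (cong (p ∸_) (sym β≡)))
      (trans (proj₁ (proj₂ sizes)) (sym (cong₂ (λ α β → 2 * α + β) α≡ β≡)))
      (trans (proj₁ (proj₂ (proj₂ sizes))) (sym β≡))
      (trans (proj₂ (proj₂ (proj₂ sizes))) (sym (cong₂ (λ α β → p + 2 * α ∸ β) α≡ β≡)))
      (coefficient-large (+<+ n<N) u≤v p≤u+v)
      where
      sizes = sizes-large u<p v<p u≤v p≤u+v
      α≡ : α ≡ p ∸ v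
      α≡ = α-large u<p v<p u≤v p≤u+v
      β≡ : β ≡ p ∸ u
      β≡ = β≡p∸u {p} {q} {r} {u} {v} {w} {x} β<p qu≡1+pw rv≡1+px (IsInverseMod.positive inverse-q) u<p v<p
        (subst (λ α → α * β * q * r ≡ 1 [mod p ]) α≡ αβqr≡1)

theorem1 : ∀ {c ℓ₁ ℓ₂} (K : HeytingField c ℓ₁ ℓ₂) → let open Cyclotomic K in
    CharacteristicZero →
    ∀ (p q r : ℕ) → Prime p → Prime q → Prime r → q ≢ r → p < q → p < r →
    ∀ (ζ : HeytingField.Carrier K) → IsPrimitiveRoot (p * q * r) ζ →
    ∀ (q′ r′ : ℕ) → IsInverseMod p q q′ → IsInverseMod p r r′ →
    let α = q′ ⊓ r′ ⊓ (p ∸ q′) ⊓ (p ∸ r′) in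
    ∀ (β : ℕ) → 0 < β → β < p → α * β * q * r ≡ 1 [mod p ] →
    ∃[ a ] IsCoefficientSequence (Φ (p * q * r) ζ) a ×
    ∃[ A₊ ] ∃[ A₋ ] IsMaximum a A₊ × IsMinimum a A₋ ×
    (A₊ ℤ.≤ + ((2 * α + β) ⊓ (p ∸ β))) ×
    (ℤ.- A₋ ℤ.≤ + ((p + 2 * α ∸ β) ⊓ β))
theorem1 K char0 p q r prp prq prr q≢r p<q p<r ζ isPrimitive q′ r′ inverse-q inverse-r β _ β<p αβqr≡1
  with ℕ.≤-total q′ r′
... | inj₁ q′≤r′ = ordered-bounds K char0 prp prq prr q≢r p<q p<r ζ isPrimitive inverse-q inverse-r q′≤r′ β<p αβqr≡1
... | inj₂ r′≤q′ = subst₂ (λ n α → CoefficientBounds K n ζ ((2 * α + β) ⊓ (p ∸ β)) ((p + 2 * α ∸ β) ⊓ β)) prq≡pqr α-sym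
  (ordered-bounds K char0 prp prr prq (λ r≡q → q≢r (sym r≡q)) p<r p<q ζ
    (subst (λ n → Cyclotomic.IsPrimitiveRoot K n ζ) (sym prq≡pqr) isPrimitive) inverse-r inverse-q r′≤q′ β<p
    (subst (λ n → n ≡ 1 [mod p ])
      (trans (*-swap ((q′ ⊓ r′ ⊓ (p ∸ q′) ⊓ (p ∸ r′)) * β) q r) (cong (λ α → α * β * r * q) (sym α-sym))) αβqr≡1))
  where
  *-swap : ∀ p q r → p * q * r ≡ p * r * q
  *-swap = ℕ-Solver.solve-∀
  prq≡pqr : p * r * q ≡ p * q * r
  prq≡pqr = *-swap p r q
  α-sym : r′ ⊓ q′ ⊓ (p ∸ r′) ⊓ (p ∸ q′) ≡ q′ ⊓ r′ ⊓ (p ∸ q′) ⊓ (p ∸ r′)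
  α-sym = begin
    r′ ⊓ q′ ⊓ (p ∸ r′) ⊓ (p ∸ q′)    ≡⟨ cong (λ m → m ⊓ (p ∸ r′) ⊓ (p ∸ q′)) (ℕ.⊓-comm r′ q′) ⟩
    q′ ⊓ r′ ⊓ (p ∸ r′) ⊓ (p ∸ q′)    ≡⟨ ℕ.⊓-assoc (q′ ⊓ r′) (p ∸ r′) (p ∸ q′) ⟩
    q′ ⊓ r′ ⊓ ((p ∸ r′) ⊓ (p ∸ q′))  ≡⟨ cong ((q′ ⊓ r′) ⊓_) (ℕ.⊓-comm (p ∸ r′) (p ∸ q′)) ⟩
    q′ ⊓ r′ ⊓ ((p ∸ q′) ⊓ (p ∸ r′))  ≡⟨ ℕ.⊓-assoc (q′ ⊓ r′) (p ∸ q′) (p ∸ r′) ⟨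
    q′ ⊓ r′ ⊓ (p ∸ q′) ⊓ (p ∸ r′)    ∎
    where open ≡-Reasoning
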